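{- Let $\pi\in\mathfrak{S}_m$. If $\pi_1=1$, $\pi_m=m$, and $|\mathcal{O}_\pi|=2$, then $\pi$ and its reversal $\pi^R=\pi_m\pi_{m-1}\cdots\pi_1$ are super-strongly c-Wilf equivalent.
   Context: The standardization $\operatorname{st}(w)$ of a word of distinct integers replaces its smallest entry by 1, the next smallest by 2, etc. For $\pi\in\mathfrak{S}_m$ and $\sigma\in\mathfrak{S}_n$, $\operatorname{Em}(\pi,\sigma)=\{i\in[n-m+1]:\operatorname{st}(\sigma_i\cdots\sigma_{i+m-1})=\pi\}$. For a set $S$ of positive integers, $a^\pi_{n,S}$ is the number of $\sigma\in\mathfrak{S}_n$ with $\operatorname{Em}(\pi,\sigma)=S$; $\pi,\tau$ are super-strongly c-Wilf equivalent if $a^\pi_{n,S}=a^\tau_{n,S}$ for all $n,S$. The overlap set is $\mathcal{O}_\pi=\{i\in[m-1]:\operatorname{st}(\pi_{i+1}\cdots\pi_m)=\operatorname{st}(\pi_1\cdots\pi_{m-i})\}$. -}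

module Defs where

open import Level using (Level; 0ℓ; _⊔_)
open import Data.Nat using (ℕ; suc; pred; _+_; _∸_; _≤_; _<_; _≤?_)
open import Data.Fin using (Fin; toℕ)
open import Data.Fin.Permutation using (Permutation′; _⟨$⟩ʳ_; reverse; _∘ₚ_)
open import Data.List using (List; map; length; filter; take; drop; tabulate)
open import Data.Product using (Σ; _×_; proj₁)
open import Function.Bundles using (Inverse; _⇔_)
open import Relation.Binary.Bundles using (Setoid)
import Relation.Binary.Construct.On as On
open import Relation.Binary.PropositionalEquality using (_≡_; setoid; _→-setoid_)
open import Relation.Unary using (Pred; _⊆_; _≐_)

private
  variable
    a ℓ p : Level
    m n : ℕ

-- Permutations of Fin n up to pointwise equality.
𝔖 : ℕ → Setoid 0ℓ 0ℓ
𝔖 n = On.setoid {B = Permutation′ n} (Fin n →-setoid Fin n) _⟨$⟩ʳ_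

-- One-line notation σ₁σ₂⋯σₙ, with letters in {1,…,n} rather than Fin n.
word : Permutation′ n → List ℕ
word σ = tabulate (λ i → suc (toℕ (σ ⟨$⟩ʳ i)))

_ᴿ : Permutation′ n → Permutation′ n
π ᴿ = reverse ∘ₚ π

-- In a word with distinct letters, the k-th smallest letter is the one that
-- has exactly k letters less than or equal to it.
st : List ℕ → List ℕ
st w = map (λ x → length (filter (_≤? x) w)) w

-- Positions are 1-based, so σᵢ⋯σᵢ₊ₘ₋₁ is obtained by dropping i - 1 letters.
-- The bound i ≤ n - m + 1 is written additively because, with truncated
-- subtraction, n ∸ m + 1 would be wrong for n < m.
Em : Permutation′ m → Permutation′ n → Pred ℕ 0ℓ
Em {m} {n} π σ i =
  1 ≤ i × i + m ≤ n + 1 × st (take m (drop (pred i) (word σ))) ≡ word π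

Overlap : Permutation′ m → Pred ℕ 0ℓ
Overlap {m} π i =
  1 ≤ i × i < m × st (drop i (word π)) ≡ st (take (m ∸ i) (word π))

-- "The number of elements of A satisfying P is k": a bijection between Fin k
-- and { x ∈ A | P x }, where elements of the latter are compared in A only,
-- ignoring the proofs of P.
HasSize : (A : Setoid a ℓ) → Pred (Setoid.Carrier A) p → ℕ → Set (a ⊔ ℓ ⊔ p)
HasSize A P k =
  Inverse (setoid (Fin k)) (On.setoid {B = Σ (Setoid.Carrier A) P} A proj₁)

-- "a^π_{n,S} = k".  This is a relation rather than a function because S is an
-- arbitrary, possibly infinite or undecidable, set.
Count : Permutation′ m → (n : ℕ) → Pred ℕ 0ℓ → ℕ → Set
Count π n S k = HasSize (𝔖 n) (λ σ → Em π σ ≐ S) k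

SuperStronglyCWilfEquivalent : Permutation′ m → Permutation′ m → Set₁
SuperStronglyCWilfEquivalent π τ =
  ∀ (n : ℕ) (S : Pred ℕ 0ℓ) → S ⊆ (1 ≤_) →
  ∀ (k : ℕ) → Count π n S k ⇔ Count τ n S k

{-# OPTIONS --safe #-}
module Submission where

-- By inclusion–exclusion it suffices to compare, for every finite set of marks s, the numbers of
-- permutations with occurrences of π, respectively of its reversal, at all the marks (and possibly
-- elsewhere). Call a position interior if it lies strictly inside the window of a mark. Since π
-- starts with its minimum and ends with its maximum, a position that is not interior separates
-- smaller from larger values within its cluster of linked windows; so on a cluster σ increases from
-- block to block, where the blocks are the maximal runs of interior positions and the remaining
-- single positions. Besides the trivial overlap m - 1 there is only one displacement between
-- overlapping windows, so the windows inside a block form a symmetric set, and reflecting the block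
-- turns occurrences of π into occurrences of its reversal. Reflecting every block in place and making
-- the values decrease from block to block, with the set of values of each cluster kept, is an
-- injection from the permutations marked for π to those marked for the reversal. The inequality in
-- the other direction is the same one for the reverse complement of π, conjugated by complementation.

open import Defs
open import Level using (Level; 0ℓ)
open import Data.Bool using (if_then_else_)
open import Data.Empty using (⊥-elim)
open import Data.Nat
open import Data.Nat.Properties
open import Data.Nat.Induction using (<-rec)
open import Data.Fin using (Fin; zero; suc; toℕ; fromℕ<; opposite; finToFun; funToFin; combine)
open import Data.Fin.Properties
  using (toℕ<n; toℕ-fromℕ<; fromℕ<-toℕ; toℕ-injective; opposite-prop; funToFin-finToFin; finToFun-funToFin)
import Data.Fin.Properties as Fin
import Data.Fin.Permutation as Perm
open import Data.Fin.Permutation using (Permutation′; permutation; _⟨$⟩ʳ_; _⟨$⟩ˡ_; _≈_)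
open import Data.List
  using (List; []; _∷_; head; last; map; length; filter; take; drop; tabulate; applyUpTo; upTo)
open import Data.List.Properties using (map-applyUpTo; ∷-injective; ≡-dec; tabulate-cong)
open import Data.List.Membership.Propositional using (_∈_)
open import Data.List.Membership.Propositional.Properties using (∈-upTo⁺)
open import Data.List.Membership.DecPropositional _≟_ using (_∈?_)
open import Data.List.Relation.Unary.All as All using (All; []; _∷_; all?)
open import Data.List.Relation.Unary.All.Properties using (all-upTo)
open import Data.Maybe using (just)
open import Data.Maybe.Properties using (just-injective)
open import Data.Product using (Σ; ∃-syntax; _×_; _,_; proj₁; proj₂)
open import Data.Sum using (_⊎_; inj₁; inj₂)
open import Function using (_∘_; id; flip; Inverse; mk⇔)
open import Relation.Binary.Bundles using (Setoid)
open import Relation.Binary.Definitions using (tri<; tri≈; tri>)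
open import Relation.Binary.PropositionalEquality
  using (_≡_; _≢_; refl; sym; trans; cong; cong₂; subst; subst₂; setoid; module ≡-Reasoning)
open import Relation.Nullary using (¬_; Dec; yes; no; does; contradiction)
open import Relation.Nullary.Decidable using (_×-dec_; _→-dec_; ¬?; map′)
open import Relation.Unary using (Pred; Decidable; _≐_)

private
  variable
    ℓ ℓ′ : Level

-- Counting

count : ∀ {n} {P : Pred (Fin n) ℓ} → Decidable P → ℕ
count {n = zero}  P? = 0
count {n = suc n} P? = (if does (P? zero) then suc else id) (count (P? ∘ suc))

count-mono : ∀ {n} {P : Pred (Fin n) ℓ} {Q : Pred (Fin n) ℓ′}
  (P? : Decidable P) (Q? : Decidable Q) →
  (∀ i → P i → Q i) → count P? ≤ count Q?
count-mono {n = zero}  P? Q? P⇒Q = z≤n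
count-mono {n = suc n} P? Q? P⇒Q
  with P? zero | Q? zero | count-mono (P? ∘ suc) (Q? ∘ suc) (P⇒Q ∘ suc)
... | yes p | yes q | ih = s≤s ih
... | yes p | no ¬q | ih = contradiction (P⇒Q zero p) ¬q
... | no ¬p | yes q | ih = m≤n⇒m≤1+n ih
... | no ¬p | no ¬q | ih = ih

count-strict : ∀ {n} {P : Pred (Fin n) ℓ} {Q : Pred (Fin n) ℓ′}
  (P? : Decidable P) (Q? : Decidable Q) →
  (∀ i → P i → Q i) → ∀ z → ¬ P z → Q z → count P? < count Q?
count-strict {n = suc n} P? Q? P⇒Q zero ¬pz qz
  with P? zero | Q? zero | count-mono (P? ∘ suc) (Q? ∘ suc) (P⇒Q ∘ suc)
... | yes p | _     | ih = contradiction p ¬pz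
... | no _  | no ¬q | ih = contradiction qz ¬q
... | no _  | yes q | ih = s≤s ih
count-strict {n = suc n} P? Q? P⇒Q (suc z) ¬pz qz
  with P? zero | Q? zero | count-strict (P? ∘ suc) (Q? ∘ suc) (P⇒Q ∘ suc) z ¬pz qz
... | yes p | yes q | ih = s≤s ih
... | yes p | no ¬q | ih = contradiction (P⇒Q zero p) ¬q
... | no ¬p | yes q | ih = m≤n⇒m≤1+n ih
... | no ¬p | no ¬q | ih = ih

count-cong : ∀ {n} {P : Pred (Fin n) ℓ} {Q : Pred (Fin n) ℓ′}
  (P? : Decidable P) (Q? : Decidable Q) →
  (∀ i → P i → Q i) → (∀ i → Q i → P i) → count P? ≡ count Q?
count-cong P? Q? P⇒Q Q⇒P = ≤-antisym (count-mono P? Q? P⇒Q) (count-mono Q? P? Q⇒P)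

count-< : ∀ {n} t → t ≤ n → count {n = n} (λ i → toℕ i <? t) ≡ t
count-< {n = zero}  zero    z≤n       = refl
count-< {n = suc n} zero    z≤n       = trans
  (count-cong {n = n} (λ i → suc (toℕ i) <? 0) (λ i → toℕ i <? 0) (λ _ ()) (λ _ ()))
  (count-< {n = n} 0 z≤n)
count-< {n = suc n} (suc t) (s≤s t≤n) = cong suc (trans
  (count-cong {n = n} (λ i → suc (toℕ i) <? suc t) (λ i → toℕ i <? t) (λ _ → s<s⁻¹) (λ _ → s<s))
  (count-< {n = n} t t≤n))

-- Ranks with respect to a key

module Rank (n : ℕ) where

  abstract
    rank : (ℕ → ℕ) → ℕ → ℕ
    rank k x = count {n = n} (λ i → k (toℕ i) <? k x)

    rank-< : ∀ k {x y} → x < n → k x < k y → rank k x < rank k y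
    rank-< k {x} {y} x<n kx<ky = count-strict _ _ (λ _ p → <-trans p kx<ky) (fromℕ< x<n)
      (λ p → <-irrefl (cong k (toℕ-fromℕ< x<n)) p)
      (subst (λ z → k z < k y) (sym (toℕ-fromℕ< x<n)) kx<ky)

    rank-reflects-< : ∀ k {x y} → rank k x < rank k y → k x < k y
    rank-reflects-< k {x} {y} r with k x <? k y
    ... | yes p = p
    ... | no ¬p = contradiction r (≤⇒≯ (count-mono {n = n}
          (λ i → k (toℕ i) <? k y) (λ i → k (toℕ i) <? k x) (λ _ p → <-≤-trans p (≮⇒≥ ¬p))))

    rank-bound : ∀ k {x} → x < n → rank k x < n
    rank-bound k {x} x<n = <-≤-trans
      (count-strict {n = n} _ (λ i → toℕ i <? n) (λ i _ → toℕ<n i) (fromℕ< x<n)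
        (<-irrefl (cong k (toℕ-fromℕ< x<n))) (toℕ<n _))
      (≤-reflexive (count-< {n = n} n ≤-refl))

    rank-cong : ∀ k k′ {x} →
      (∀ {y} → y < n → k y < k x → k′ y < k′ x) → (∀ {y} → y < n → k′ y < k′ x → k y < k x) →
      rank k x ≡ rank k′ x
    rank-cong k k′ f g = count-cong _ _ (λ i → f (toℕ<n i)) (λ i → g (toℕ<n i))

    -- The keys below k x include those of all smaller labels and of no larger ones, and the
    -- positions with smaller labels form an initial segment.
    rank-fibre : ∀ k (c : ℕ → ℕ) → (∀ {x y} → x ≤ y → c x ≤ c y) →
      (∀ {x y} → x < n → y < n → c x < c y → k x < k y) →
      ∀ {x} → x < n → c (rank k x) ≡ c x
    rank-fibre k c mono refines {x} x<n with rank-bound k x<n | <-cmp (c (rank k x)) (c x)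
    ... | r<n | tri≈ _ e _ = e
    -- Otherwise the `suc (rank k x)` positions up to the rank would all have keys below `k x`, one
    -- more than the rank counts.
    ... | r<n | tri< l _ _ = contradiction
      (≤-trans (≤-reflexive (sym (count-< {n = n} (suc (rank k x)) r<n)))
        (count-mono {n = n} (λ i → toℕ i <? suc (rank k x)) (λ i → k (toℕ i) <? k x)
          (λ i p → refines (toℕ<n i) x<n (≤-<-trans (mono (s≤s⁻¹ p)) l))))
      (<-irrefl refl)
    -- Here all keys below `k x` sit at positions below the rank, and so does `x`, whose own key is
    -- not among them; that leaves too few.
    ... | r<n | tri> _ _ g = contradiction
      (<-≤-trans
        (count-strict {n = n} (λ i → k (toℕ i) <? k x) (λ i → toℕ i <? rank k x)
          below (fromℕ< x<n)
          (<-irrefl (cong k (toℕ-fromℕ< x<n)))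
          (subst (_< rank k x) (sym (toℕ-fromℕ< x<n)) x<r))
        (≤-reflexive (count-< {n = n} (rank k x) (<⇒≤ r<n))))
      (<-irrefl refl)
      where
      below : ∀ (i : Fin n) → k (toℕ i) < k x → toℕ i < rank k x
      below i p with toℕ i <? rank k x
      ... | yes q = q
      ... | no ¬q = contradiction p (<-asym (refines x<n (toℕ<n i) (<-≤-trans g (mono (≮⇒≥ ¬q)))))
      x<r : x < rank k x
      x<r with x <? rank k x
      ... | yes q = q
      ... | no ¬q = contradiction g (≤⇒≯ (mono (≮⇒≥ ¬q)))

-- Permutations of an initial segment of ℕ

record IsPerm (n : ℕ) (f : ℕ → ℕ) : Set where
  field
    bounded   : ∀ {x} → x < n → f x < n
    injective : ∀ {x y} → x < n → y < n → f x ≡ f y → x ≡ y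

  reflects-< : (k : ℕ → ℕ) → ∀ {x y} → x < n → y < n →
    (f y < f x → k y < k x) → k x < k y → f x < f y
  reflects-< k {x} {y} x<n y<n h kx<ky with <-cmp (f x) (f y)
  ... | tri< l _ _ = l
  ... | tri≈ _ e _ = contradiction kx<ky (<-irrefl (cong k (injective x<n y<n e)))
  ... | tri> _ _ g = contradiction kx<ky (<-asym (h g))

  -- Pigeonhole: if `y` were missed, `y` together with the values of `f` would inject `Fin (suc n)`
  -- into `Fin n`.
  surjective : ∀ {y} → y < n → ∃[ x ] x < n × f x ≡ y
  surjective {y} y<n with anyUpTo? (λ x → f x ≟ y) n
  ... | yes p = p
  ... | no ¬p = contradiction
    (Fin.injective⇒≤ {m = suc n} {n = n} {f = g} g-injective) 1+n≰n
    where
    g : Fin (suc n) → Fin n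
    g zero    = fromℕ< y<n
    g (suc i) = fromℕ< (bounded (toℕ<n i))
    g-injective : ∀ {i j} → g i ≡ g j → i ≡ j
    g-injective {zero}  {zero}  e = refl
    g-injective {zero}  {suc j} e =
      ⊥-elim (¬p (toℕ j , toℕ<n j , sym (Fin.fromℕ<-injective _ _ y<n (bounded (toℕ<n j)) e)))
    g-injective {suc i} {zero}  e =
      ⊥-elim (¬p (toℕ i , toℕ<n i , Fin.fromℕ<-injective _ _ (bounded (toℕ<n i)) y<n e))
    g-injective {suc i} {suc j} e = cong suc (toℕ-injective (injective (toℕ<n i) (toℕ<n j)
      (Fin.fromℕ<-injective _ _ (bounded (toℕ<n i)) (bounded (toℕ<n j)) e)))

rank-perm : ∀ {n} k → (∀ {x y} → x < n → y < n → k x ≡ k y → x ≡ y) → IsPerm n (Rank.rank n k)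
rank-perm {n} k k-inj = record { bounded = rank-bound k ; injective = inj }
  where
  open Rank n
  inj : ∀ {x y} → x < n → y < n → rank k x ≡ rank k y → x ≡ y
  inj {x} {y} x<n y<n e with <-cmp (k x) (k y)
  ... | tri< l _ _ = contradiction e (<⇒≢ (rank-< k x<n l))
  ... | tri≈ _ p _ = k-inj x<n y<n p
  ... | tri> _ _ g = contradiction (sym e) (<⇒≢ (rank-< k y<n g))

-- Labelling the classes of adjacent linked positions

module Label {R : Pred ℕ ℓ} (R? : Decidable R) where

  abstract
    -- `R t` is read as a link between `t` and `suc t`. The label counts the missing links to the
    -- left, so equal labels mean the same run of linked positions.
    label : ℕ → ℕ
    label zero    = 0
    label (suc x) = if does (R? x) then label x else suc (label x)

    label-step : ∀ x → label x ≤ label (suc x)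
    label-step x with R? x
    ... | yes _ = ≤-refl
    ... | no  _ = n≤1+n _

    label-mono : ∀ {x y} → x ≤ y → label x ≤ label y
    label-mono {x} {zero}  z≤n = ≤-refl
    label-mono {x} {suc y} x≤y with m≤n⇒m<n∨m≡n x≤y
    ... | inj₂ refl = ≤-refl
    ... | inj₁ x<y  = ≤-trans (label-mono (s≤s⁻¹ x<y)) (label-step y)

    label-bound : ∀ x → label x ≤ x
    label-bound zero = z≤n
    label-bound (suc x) with R? x
    ... | yes _ = m≤n⇒m≤1+n (label-bound x)
    ... | no  _ = s≤s (label-bound x)

    linked⇒≡ : ∀ {x y} → x ≤ y → (∀ {t} → x ≤ t → t < y → R t) → label x ≡ label y
    linked⇒≡ {x} {zero}  z≤n h = refl
    linked⇒≡ {x} {suc y} x≤y h with m≤n⇒m<n∨m≡n x≤y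
    ... | inj₂ refl = refl
    ... | inj₁ x<y with R? y
    ...   | yes _ = linked⇒≡ (s≤s⁻¹ x<y) (λ x≤t t<y → h x≤t (m<n⇒m<1+n t<y))
    ...   | no ¬r = contradiction (h (s≤s⁻¹ x<y) ≤-refl) ¬r

    ≡⇒linked : ∀ {x y} → label x ≡ label y → ∀ {t} → x ≤ t → t < y → R t
    ≡⇒linked {x} {y} e {t} x≤t t<y with R? t | label-mono x≤t | label-mono t<y
    ... | yes r | _ | _ = r
    ... | no  _ | p | q = contradiction (≤-trans (≤-trans (s≤s p) q) (≤-reflexive (sym e))) (<-irrefl refl)

lex-< : ∀ {n a b u v} → a < b → u < n → a * n + u < b * n + v
lex-< {n} {a} {b} {u} {v} a<b u<n = begin-strict
  a * n + u  <⟨ +-monoʳ-< (a * n) u<n ⟩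
  a * n + n  ≡⟨ +-comm (a * n) n ⟩
  suc a * n  ≤⟨ *-monoˡ-≤ n a<b ⟩
  b * n      ≤⟨ m≤m+n (b * n) v ⟩
  b * n + v  ∎
  where open ≤-Reasoning

-- Occurrences of a pattern at prescribed positions

-- A pattern of length M + 1 is given by the order that it induces on {0,…,M}.
SelfOverlap : (M : ℕ) (_≺_ : ℕ → ℕ → Set) → ℕ → Set
SelfOverlap M _≺_ d = 0 < d × d < M ×
  (∀ {a b} → a + d ≤ M → b + d ≤ M → a ≺ b → (a + d) ≺ (b + d))

Reversed : (M : ℕ) (_≺_ : ℕ → ℕ → Set) → ℕ → ℕ → Set
Reversed M _≺_ a b = (M ∸ a) ≺ (M ∸ b)

-- One implication suffices: for a total order `_≺_` the converse follows by trichotomy. Positions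
-- are 0-based here, and `M` is the offset of the last letter.
Occurs : (M : ℕ) (_≺_ : ℕ → ℕ → Set) (f : ℕ → ℕ) → ℕ → Set
Occurs M _≺_ f s = ∀ {a b} → a ≤ M → b ≤ M → a ≺ b → f (s + a) < f (s + b)

-- The hypotheses on the pattern in terms of its order alone, in a form stable under reverse
-- complement. `SelfOverlap` excludes the displacement `M`, so `unique` concerns the overlaps other
-- than the trivial one.
record Good (M : ℕ) (_≺_ : ℕ → ℕ → Set) : Set where
  field
    1<M     : 1 < M
    tri     : ∀ {a b} → a ≤ M → b ≤ M → a ≺ b ⊎ a ≡ b ⊎ b ≺ a
    asym    : ∀ {a b} → a ≤ M → b ≤ M → a ≺ b → ¬ b ≺ a
    min     : ∀ {a} → 0 < a → a ≤ M → 0 ≺ a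
    max     : ∀ {a} → a < M → a ≺ M
    unique  : ∀ {d e} → SelfOverlap M _≺_ d → SelfOverlap M _≺_ e → d ≡ e

  irrefl : ∀ {a} → a ≤ M → ¬ a ≺ a
  irrefl a≤M p = asym a≤M a≤M p p

  0<M : 0 < M
  0<M = <-trans z<s 1<M

-- Blocks and clusters of a set of marks

module Core (n M : ℕ) (0<M : 0 < M) {Mark : Pred ℕ 0ℓ} (Mark? : Decidable Mark)
  (bnd : ∀ {s} → Mark s → s + M < n) where

  open Rank n
  open IsPerm

  Int : Pred ℕ 0ℓ
  Int p = ∃[ s ] s < p × Mark s × p < s + M

  Int? : Decidable Int
  Int? p = anyUpTo? (λ s → Mark? s ×-dec p <? s + M) p

  -- A link at `x` joins `x` to `suc x`: some window contains both. Hence `s` may equal `x`, in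
  -- contrast to the strict `s < p` in `Int`.
  Link : Pred ℕ 0ℓ
  Link x = ∃[ s ] s < suc x × Mark s × x < s + M

  Link? : Decidable Link
  Link? x = anyUpTo? (λ s → Mark? s ×-dec x <? s + M) (suc x)

  Int⇒< : ∀ {p} → Int p → p < n
  Int⇒< (s , _ , ms , p<) = <-trans p< (bnd ms)

  -- Linking only interior neighbours makes every maximal run of interior positions one block and
  -- every other position a block by itself.
  Both : Pred ℕ 0ℓ
  Both x = Int x × Int (suc x)

  module Blk = Label {R = Both} (λ x → Int? x ×-dec Int? (suc x))
  module Clu = Label Link?
  open Blk using () renaming (label to blk)
  open Clu using () renaming (label to clu)

  Int⇒Link : ∀ {x} → Int x → Link x
  Int⇒Link (s , s<x , ms , x<) = s , m<n⇒m<1+n s<x , ms , x<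

  -- If the block labels agreed, every step from `x` to `y` would start at an interior position and
  -- thus be a link, so the clusters would agree as well.
  blk-refines-clu : ∀ {x y} → clu x < clu y → blk x < blk y
  blk-refines-clu {x} {y} l with x ≤? y
  ... | no ¬p = contradiction l (≤⇒≯ (Clu.label-mono (<⇒≤ (≰⇒> ¬p))))
  ... | yes x≤y with m≤n⇒m<n∨m≡n (Blk.label-mono x≤y)
  ...   | inj₁ p = p
  ...   | inj₂ e = contradiction l (<-irrefl (Clu.linked⇒≡ x≤y
            (λ x≤t t<y → Int⇒Link (proj₁ (Blk.≡⇒linked e x≤t t<y)))))

  blk≡⇒clu≡ : ∀ {x y} → blk x ≡ blk y → clu x ≡ clu y
  blk≡⇒clu≡ {x} {y} e with <-cmp (clu x) (clu y)
  ... | tri< l _ _ = contradiction e (<⇒≢ (blk-refines-clu l))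
  ... | tri≈ _ p _ = p
  ... | tri> _ _ g = contradiction (sym e) (<⇒≢ (blk-refines-clu g))

  blk≡⇒Int : ∀ {x y t} → blk x ≡ blk y → x ≤ t → t ≤ y → x < y → Int t
  blk≡⇒Int {x} {y} {t} e x≤t t≤y x<y with m≤n⇒m<n∨m≡n t≤y
  ... | inj₁ t<y  = proj₁ (Blk.≡⇒linked {x} {y} e x≤t t<y)
  blk≡⇒Int {x} {suc y} e x≤t t≤y x<y | inj₂ refl = proj₂ (Blk.≡⇒linked {x} {suc y} e (s≤s⁻¹ x<y) ≤-refl)

  Int⇒blk≡ : ∀ {x y} → x ≤ y → (∀ {t} → x ≤ t → t ≤ y → Int t) → blk x ≡ blk y
  Int⇒blk≡ x≤y h = Blk.linked⇒≡ x≤y (λ x≤t t<y → h x≤t (<⇒≤ t<y) , h (m≤n⇒m≤1+n x≤t) t<y)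

  -- If all positions from `x` to `y` were interior, they would form one run. The position found may
  -- be `x` or `y` itself.
  break : ∀ {x y} → x ≤ y → blk x ≢ blk y → ∃[ b ] x ≤ b × b ≤ y × ¬ Int b
  break {x} {y} x≤y ne with anyUpTo? (λ b → x ≤? b ×-dec ¬? (Int? b)) (suc y)
  ... | yes (b , b≤y , x≤b , ¬i) = b , x≤b , s≤s⁻¹ b≤y , ¬i
  ... | no ¬p = contradiction (Int⇒blk≡ x≤y int) ne
    where
    int : ∀ {t} → x ≤ t → t ≤ y → Int t
    int {t} x≤t t≤y with Int? t
    ... | yes i = i
    ... | no ¬i = contradiction (t , s≤s t≤y , x≤t , ¬i) ¬p

  clu-window : ∀ {s a} → Mark s → a ≤ M → clu s ≡ clu (s + a)
  clu-window {s} {a} ms a≤M = Clu.linked⇒≡ (m≤m+n s a)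
    (λ s≤t t<s+a → s , s≤s s≤t , ms , <-≤-trans t<s+a (+-monoʳ-≤ s a≤M))

  -- L and H are the exclusive ends of a maximal run of interior positions.
  record Block (x : ℕ) : Set where
    field
      L H   : ℕ
      L<x   : L < x
      x<H   : x < H
      ¬IntL : ¬ Int L
      ¬IntH : ¬ Int H
      inner : ∀ {t} → L < t → t < H → Int t

  open Block

  lower-end : ∀ {x} → Int x → ∃[ L ] L < x × ¬ Int L × (∀ {t} → L < t → t ≤ x → Int t)
  lower-end {zero}  (_ , () , _)
  lower-end {suc x} i with Int? x
  ... | no ¬i = x , ≤-refl , ¬i , λ x<t t≤ → subst Int (≤-antisym x<t t≤) i
  ... | yes j with lower-end j
  ...   | L , L<x , ¬L , h = L , m<n⇒m<1+n L<x , ¬L , g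
    where
    g : ∀ {t} → L < t → t ≤ suc x → Int t
    g L<t t≤ with m≤n⇒m<n∨m≡n t≤
    ... | inj₁ t< = h L<t (s≤s⁻¹ t<)
    ... | inj₂ refl = i

  -- `k` is fuel for the scan to the right: when it is used up, `x` is at least `n`, but interior
  -- positions lie below `n`.
  upper-end : ∀ k {x} → n ≤ x + k → Int x → ∃[ H ] x < H × ¬ Int H × (∀ {t} → x ≤ t → t < H → Int t)
  upper-end zero {x} n≤ i = contradiction (Int⇒< i) (≤⇒≯ (≤-trans n≤ (≤-reflexive (+-identityʳ x))))
  upper-end (suc k) {x} n≤ i with Int? (suc x)
  ... | no ¬i = suc x , ≤-refl , ¬i , λ x≤t t< → subst Int (≤-antisym x≤t (s≤s⁻¹ t<)) i
  ... | yes j with upper-end k (≤-trans n≤ (≤-reflexive (+-suc x k))) j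
  ...   | H , x<H , ¬H , h = H , <-trans ≤-refl x<H , ¬H , g
    where
    g : ∀ {t} → x ≤ t → t < H → Int t
    g x≤t t< with m≤n⇒m<n∨m≡n x≤t
    ... | inj₁ x<t  = h x<t t<
    ... | inj₂ refl = i

  block : ∀ {x} → Int x → Block x
  block {x} i with lower-end i | upper-end n (m≤n+m n x) i
  ... | L , L<x , ¬L , h | H , x<H , ¬H , g = record
    { L = L ; H = H ; L<x = L<x ; x<H = x<H ; ¬IntL = ¬L ; ¬IntH = ¬H ; inner = inn }
    where
    inn : ∀ {t} → L < t → t < H → Int t
    inn {t} p q with ≤-total t x
    ... | inj₁ t≤x = h p t≤x
    ... | inj₂ x≤t = g x≤t q

  Block-Int : ∀ {x} → Block x → Int x
  Block-Int B = inner B (L<x B) (x<H B)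

  Block-blk : ∀ {x y z} (B : Block x) → L B < y → y < H B → L B < z → z < H B → blk y ≡ blk z
  Block-blk {y = y} {z} B Ly yH Lz zH with ≤-total y z
  ... | inj₁ y≤z = Int⇒blk≡ y≤z (λ y≤t t≤z → inner B (<-≤-trans Ly y≤t) (≤-<-trans t≤z zH))
  ... | inj₂ z≤y = sym (Int⇒blk≡ z≤y (λ z≤t t≤y → inner B (<-≤-trans Lz z≤t) (≤-<-trans t≤y yH)))

  -- The two runs share `y`, so if their ends differed, an end of one would lie inside the other and
  -- be interior.
  Block-unique : ∀ {x y} (B : Block x) (C : Block y) → L B < y → y < H B → L C ≡ L B × H C ≡ H B
  Block-unique {x} {y} B C Ly yH = lo , hi
    where
    lo : L C ≡ L B
    lo with <-cmp (L C) (L B)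
    ... | tri≈ _ e _ = e
    ... | tri< l _ _ = contradiction (inner C l (<-trans Ly (x<H C))) (¬IntL B)
    ... | tri> _ _ g = contradiction (inner B g (<-trans (L<x C) yH)) (¬IntL C)
    hi : H C ≡ H B
    hi with <-cmp (H C) (H B)
    ... | tri≈ _ e _ = e
    ... | tri< l _ _ = contradiction (inner B (<-trans Ly (x<H C)) l) (¬IntH C)
    ... | tri> _ _ g = contradiction (inner C (<-trans (L<x C) yH) g) (¬IntH B)

  -- Reflection of the blocks

  abstract
    ψ : ℕ → ℕ
    ψ x with Int? x
    ... | yes i = (L (block i) + H (block i)) ∸ x
    ... | no  _ = x

    -- The reflection in additive form, free of truncated subtraction. Any `B` around `x` will do,
    -- since the ends of a run are unique.
    ψ-Block : ∀ {x} (B : Block x) → ψ x + x ≡ L B + H B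
    ψ-Block {x} B with Int? x
    ... | no ¬i = contradiction (Block-Int B) ¬i
    ... | yes i with Block-unique B (block i) (L<x B) (x<H B)
    ...   | p , q = trans
      (m∸n+n≡m (≤-trans (<⇒≤ (x<H (block i))) (m≤n+m _ (L (block i)))))
      (cong₂ _+_ p q)

    ψ-¬Int : ∀ {x} → ¬ Int x → ψ x ≡ x
    ψ-¬Int {x} ¬i with Int? x
    ... | yes i = contradiction i ¬i
    ... | no  _ = refl

  ψ-inside : ∀ {x} (B : Block x) → L B < ψ x × ψ x < H B
  ψ-inside {x} B = ≰⇒> lo , ≰⇒> hi
    where
    lo : ¬ ψ x ≤ L B
    lo p = <-irrefl (ψ-Block B) (+-mono-≤-< p (x<H B))
    hi : ¬ H B ≤ ψ x
    hi p = <-irrefl (+-comm (H B) (L B)) (subst (H B + L B <_) (ψ-Block B) (+-mono-≤-< p (L<x B)))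

  -- Otherwise `L B` would lie strictly inside the window at `s`, which reaches beyond `y`. `mark≤H`
  -- is the mirror image.
  L≤mark : ∀ {x s y} (B : Block x) → Mark s → L B < y → y < s + M → L B ≤ s
  L≤mark {s = s} B ms L<y y<s+M with L B ≤? s
  ... | yes p = p
  ... | no ¬p = contradiction (s , ≰⇒> ¬p , ms , <-trans L<y y<s+M) (¬IntL B)

  mark≤H : ∀ {x s y} (B : Block x) → Mark s → s ≤ y → y < H B → s + M ≤ H B
  mark≤H {s = s} B ms s≤y y<H with s + M ≤? H B
  ... | yes p = p
  ... | no ¬p = contradiction (s , ≤-<-trans s≤y y<H , ms , ≰⇒> ¬p) (¬IntH B)

  move : ∀ {x y} (B : Block x) → L B < y → y < H B → Block y
  move B p q = record { L = L B ; H = H B ; L<x = p ; x<H = q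
    ; ¬IntL = ¬IntL B ; ¬IntH = ¬IntH B ; inner = inner B }

  blk-ψ : ∀ x → blk (ψ x) ≡ blk x
  blk-ψ x = go (Int? x)
    where
    go : Dec (Int x) → blk (ψ x) ≡ blk x
    go (no ¬i) = cong blk (ψ-¬Int ¬i)
    go (yes i) = Block-blk B (proj₁ (ψ-inside B)) (proj₂ (ψ-inside B)) (L<x B) (x<H B)
      where B = block i

  ψ-bound : ∀ {x} → x < n → ψ x < n
  ψ-bound {x} x<n = go (Int? x)
    where
    go : Dec (Int x) → ψ x < n
    go (no ¬i) = subst (_< n) (sym (ψ-¬Int ¬i)) x<n
    go (yes i) = Int⇒< (inner B (proj₁ (ψ-inside B)) (proj₂ (ψ-inside B)))
      where B = block i

  ψ-involutive : ∀ x → ψ (ψ x) ≡ x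
  ψ-involutive x = go (Int? x)
    where
    go : Dec (Int x) → ψ (ψ x) ≡ x
    go (no ¬i) = trans (cong ψ (ψ-¬Int ¬i)) (ψ-¬Int ¬i)
    go (yes i) = +-cancelʳ-≡ (ψ x) _ _
      (trans (ψ-Block (move B (proj₁ (ψ-inside B)) (proj₂ (ψ-inside B))))
        (trans (sym (ψ-Block B)) (+-comm (ψ x) x)))
      where B = block i

  -- Sorting keys and the rearrangement of values

  abstract
    -- Lexicographic keys. On a cluster, key₁ f is ordered like f (see cluster-mono), while
    -- key₂ f reverses the order of the blocks and reflects each of them.
    key₁ key₂ : (ℕ → ℕ) → ℕ → ℕ
    key₁ f x = blk x * n + f x
    key₂ f x = (clu x * suc n + (n ∸ blk x)) * n + f (ψ x)

    key₁-blk : ∀ {f} → IsPerm n f → ∀ {x y} → x < n → blk x < blk y → key₁ f x < key₁ f y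
    key₁-blk P x<n p = lex-< p (bounded P x<n)

    key₁-in : ∀ f {x y} → blk x ≡ blk y → f x < f y → key₁ f x < key₁ f y
    key₁-in f {x} {y} e p = subst (λ b → key₁ f x < b * n + f y) e (+-monoʳ-< (blk x * n) p)

    key₂-clu : ∀ {f} → IsPerm n f → ∀ {x y} → x < n → clu x < clu y → key₂ f x < key₂ f y
    -- `n ∸ blk x` may be as large as `n`, so the cluster digit is scaled by `suc n`.
    key₂-clu P {x} x<n p = lex-< (lex-< p (s≤s (m∸n≤m n (blk x)))) (bounded P (ψ-bound x<n))

    key₂-blk : ∀ {f} → IsPerm n f → ∀ {x y} → x < n → clu x ≡ clu y → blk y < blk x →
      key₂ f x < key₂ f y
    key₂-blk {f} P {x} {y} x<n e p = lex-< {n = n} {a = clu x * suc n + (n ∸ blk x)}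
      (subst (λ c → clu x * suc n + (n ∸ blk x) < c * suc n + (n ∸ blk y)) e
        -- `blk x ≤ x < n`, so the subtraction is not truncated and reverses the order of the
        -- blocks.
        (+-monoʳ-< (clu x * suc n) (∸-monoʳ-< p (≤-trans (Blk.label-bound x) (<⇒≤ x<n)))))
      (bounded P (ψ-bound x<n))

    key₂-in : ∀ f {x y} → blk x ≡ blk y → f (ψ x) < f (ψ y) → key₂ f x < key₂ f y
    key₂-in f {x} {y} e p = subst₂ (λ c b → key₂ f x < (c * suc n + (n ∸ b)) * n + f (ψ y))
      (blk≡⇒clu≡ e) e (+-monoʳ-< ((clu x * suc n + (n ∸ blk x)) * n) p)

  key₁-injective : ∀ {f} → IsPerm n f → ∀ {x y} → x < n → y < n → key₁ f x ≡ key₁ f y → x ≡ y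
  key₁-injective {f} P {x} {y} x<n y<n e with <-cmp (blk x) (blk y)
  ... | tri< l _ _ = contradiction e (<⇒≢ (key₁-blk P x<n l))
  ... | tri> _ _ g = contradiction (sym e) (<⇒≢ (key₁-blk P y<n g))
  ... | tri≈ _ b _ with <-cmp (f x) (f y)
  ...   | tri< l _ _ = contradiction e (<⇒≢ (key₁-in f b l))
  ...   | tri≈ _ q _ = injective P x<n y<n q
  ...   | tri> _ _ g = contradiction (sym e) (<⇒≢ (key₁-in f (sym b) g))

  ψ-injective : ∀ {x y} → ψ x ≡ ψ y → x ≡ y
  ψ-injective {x} {y} e = trans (sym (ψ-involutive x)) (trans (cong ψ e) (ψ-involutive y))

  key₂-injective : ∀ {f} → IsPerm n f → ∀ {x y} → x < n → y < n → key₂ f x ≡ key₂ f y → x ≡ y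
  key₂-injective {f} P {x} {y} x<n y<n e with <-cmp (clu x) (clu y)
  ... | tri< l _ _ = contradiction e (<⇒≢ (key₂-clu P x<n l))
  ... | tri> _ _ g = contradiction (sym e) (<⇒≢ (key₂-clu P y<n g))
  ... | tri≈ _ c _ with <-cmp (blk x) (blk y)
  ...   | tri< l _ _ = contradiction (sym e) (<⇒≢ (key₂-blk P y<n (sym c) l))
  ...   | tri> _ _ g = contradiction e (<⇒≢ (key₂-blk P x<n c g))
  ...   | tri≈ _ b _ with <-cmp (f (ψ x)) (f (ψ y))
  ...     | tri< l _ _ = contradiction e (<⇒≢ (key₂-in f b l))
  ...     | tri≈ _ q _ = ψ-injective (injective P (ψ-bound x<n) (ψ-bound y<n) q)
  ...     | tri> _ _ g = contradiction (sym e) (<⇒≢ (key₂-in f (sym b) g))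

  rank₁ rank₂ : (ℕ → ℕ) → ℕ → ℕ
  rank₁ f = rank (key₁ f)
  rank₂ f = rank (key₂ f)

  rank₁-perm : ∀ {f} → IsPerm n f → IsPerm n (rank₁ f)
  rank₁-perm {f} P = rank-perm (key₁ f) (key₁-injective P)

  rank₂-perm : ∀ {f} → IsPerm n f → IsPerm n (rank₂ f)
  rank₂-perm {f} P = rank-perm (key₂ f) (key₂-injective P)

  -- Both keys sort by cluster first, and clusters are intervals of positions. Hence
  -- `rank₁ f u ≡ rank₂ f x` puts `u` and `x` into one cluster, and `Φ` keeps the set of values of
  -- each cluster.
  clu-rank₁ : ∀ {f} → IsPerm n f → ∀ {x} → x < n → clu (rank₁ f x) ≡ clu x
  clu-rank₁ {f} P = rank-fibre (key₁ f) clu Clu.label-mono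
    (λ x<n y<n l → key₁-blk P x<n (blk-refines-clu l))

  clu-rank₂ : ∀ {f} → IsPerm n f → ∀ {x} → x < n → clu (rank₂ f x) ≡ clu x
  clu-rank₂ {f} P = rank-fibre (key₂ f) clu Clu.label-mono (λ x<n y<n l → key₂-clu P x<n l)

  abstract
    -- Φ f = f ∘ (rank₁ f)⁻¹ ∘ rank₂ f; the junk value 0 does not occur for permutations.
    Φ : (ℕ → ℕ) → ℕ → ℕ
    Φ f x with anyUpTo? (λ u → rank₁ f u ≟ rank₂ f x) n
    ... | yes (u , _) = f u
    ... | no _        = 0

    Φ-spec : ∀ {f} → IsPerm n f → ∀ {x} → x < n →
      ∃[ u ] u < n × rank₁ f u ≡ rank₂ f x × Φ f x ≡ f u
    Φ-spec {f} P {x} x<n with anyUpTo? (λ u → rank₁ f u ≟ rank₂ f x) n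
    ... | yes (u , u<n , e) = u , u<n , e , refl
    ... | no ¬p = contradiction (surjective (rank₁-perm P) (bounded (rank₂-perm P) x<n)) ¬p

  Φ-perm : ∀ {f} → IsPerm n f → IsPerm n (Φ f)
  Φ-perm {f} P = record { bounded = bd ; injective = inj }
    where
    bd : ∀ {x} → x < n → Φ f x < n
    bd x<n with Φ-spec P x<n
    ... | u , u<n , _ , e = subst (_< n) (sym e) (bounded P u<n)
    inj : ∀ {x y} → x < n → y < n → Φ f x ≡ Φ f y → x ≡ y
    inj x<n y<n e with Φ-spec P x<n | Φ-spec P y<n
    ... | u , u<n , ru , eu | v , v<n , rv , ev =
      injective (rank₂-perm P) x<n y<n (trans (sym ru) (trans (cong (rank₁ f) u≡v) rv))
      where u≡v = injective P u<n v<n (trans (sym eu) (trans e ev))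

  -- Values at the marked occurrences of a good pattern

  module Pattern (_≺_ : ℕ → ℕ → Set) (good : Good M _≺_) where

    open Good good hiding (0<M)

    OccursAll : (ℕ → ℕ) → Set
    OccursAll f = ∀ {s} → Mark s → Occurs M _≺_ f s

    from-start : ∀ {f} → OccursAll f → ∀ {s y} → Mark s → s < suc y → y < s + M → f s < f (suc y)
    from-start {f} X {s} {y} ms p q = subst₂ (λ u v → f u < f v) (+-identityʳ s) (m+[n∸m]≡n (<⇒≤ p))
      (X ms z≤n d≤M (min (m<n⇒0<n∸m p) d≤M))
      where
      d≤M : suc y ∸ s ≤ M
      d≤M = m≤n+o⇒m∸n≤o (suc y) s q

    -- Go from `y` to the start `s` of a window containing `y` and its predecessor: the value there
    -- is smaller, as the pattern starts with its minimum. The start cannot pass `b`, which would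
    -- then be interior, so the descent ends exactly at `b`.
    above-break : ∀ {f b} → OccursAll f → ¬ Int b → ∀ y → b < y →
      (∀ {t} → b ≤ t → t < y → Link t) → f b < f y
    above-break {f} {b} X ¬i = <-rec _ step
      where
      step : ∀ y → (∀ {z} → z < y → b < z → (∀ {t} → b ≤ t → t < z → Link t) → f b < f z) →
        b < y → (∀ {t} → b ≤ t → t < y → Link t) → f b < f y
      step (suc y) ih b<y link with link (s≤s⁻¹ b<y) ≤-refl
      ... | s , s≤y , ms , y<s+M with <-cmp b s
      ...   | tri> _ _ s<b = contradiction (s , s<b , ms , ≤-<-trans (s≤s⁻¹ b<y) y<s+M) ¬i
      ...   | tri≈ _ refl _ = from-start {f} X ms s≤y y<s+M
      ...   | tri< b<s _ _  = <-trans
        (ih s≤y b<s (λ b≤t t<s → link b≤t (<-trans t<s s≤y))) (from-start {f} X ms s≤y y<s+M)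

    -- The mirror image of `above-break`, climbing to the ends of windows, where the pattern has its
    -- maximum; `k` is fuel bounding the distance to `b`.
    below-break : ∀ {f b} → OccursAll f → ¬ Int b → ∀ k {x} → b ≤ x + k → x < b →
      (∀ {t} → x ≤ t → t < b → Link t) → f x < f b
    below-break X ¬i zero {x} b≤x+0 x<b link =
      contradiction x<b (≤⇒≯ (≤-trans b≤x+0 (≤-reflexive (+-identityʳ x))))
    below-break {f} {b} X ¬i (suc k) {x} b≤x+k x<b link with link ≤-refl x<b
    ... | s , s≤x , ms , x<s+M = go (<-cmp (s + M) b)
      where
      end : f x < f (s + M)
      end = subst (λ u → f u < f (s + M)) (m+[n∸m]≡n (s≤s⁻¹ s≤x))
        (X ms (<⇒≤ d<M) ≤-refl (max d<M))
        where
        d<M : x ∸ s < M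
        d<M = +-cancelˡ-< s _ _ (subst (_< s + M) (sym (m+[n∸m]≡n (s≤s⁻¹ s≤x))) x<s+M)
      go : _ → f x < f b
      go (tri≈ _ e _) = subst (λ u → f x < f u) e end
      go (tri> _ _ g) = contradiction (s , ≤-<-trans (s≤s⁻¹ s≤x) x<b , ms , g) ¬i
      go (tri< l _ _) = <-trans end (below-break {f} X ¬i k
        (≤-trans b≤x+k (≤-trans (≤-reflexive (+-suc x k)) (+-monoˡ-≤ k x<s+M))) l
        (λ p q → link (≤-trans (<⇒≤ x<s+M) p) q))

    -- A break between `x` and `y` has a value above those to its left and below those to its right
    -- in the cluster; the break may coincide with an endpoint.
    cluster-mono : ∀ {f} → OccursAll f → ∀ {x y} → clu x ≡ clu y → blk x < blk y → f x < f y
    cluster-mono {f} X {x} {y} c p with x ≤? y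
    ... | no ¬q = contradiction p (≤⇒≯ (Blk.label-mono (<⇒≤ (≰⇒> ¬q))))
    ... | yes x≤y with break x≤y (<⇒≢ p)
    ...   | b , x≤b , b≤y , ¬i with m≤n⇒m<n∨m≡n x≤b | m≤n⇒m<n∨m≡n b≤y
    ...     | inj₁ x<b | inj₁ b<y = <-trans
      (below-break X ¬i b (m≤n+m b x) x<b (λ u v → Clu.≡⇒linked c u (<-trans v b<y)))
      (above-break X ¬i y b<y (λ u v → Clu.≡⇒linked c (≤-trans x≤b u) v))
    ...     | inj₁ x<b | inj₂ refl = below-break X ¬i b (m≤n+m b x) x<b (Clu.≡⇒linked c)
    ...     | inj₂ refl | inj₁ b<y = above-break X ¬i y b<y (Clu.≡⇒linked c)
    ...     | inj₂ refl | inj₂ refl = contradiction p (<-irrefl refl)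

    key₁-cluster : ∀ {f} → IsPerm n f → OccursAll f → ∀ {x y} → x < n → y < n → clu x ≡ clu y →
      f x < f y → key₁ f x < key₁ f y
    key₁-cluster {f} P X {x} {y} x<n y<n c p with <-cmp (blk x) (blk y)
    ... | tri< l _ _ = key₁-blk P x<n l
    ... | tri≈ _ e _ = key₁-in f e p
    ... | tri> _ _ g = contradiction p (<-asym (cluster-mono X (sym c) g))

    -- The positions `u` and `v` from which `Φ` takes its values lie in the same cluster as `x` and
    -- `y`. There `key₁ f` and `f` order alike, so the comparison passes from `key₂ f` through the
    -- ranks to `key₁ f` and on to `f`.
    Φ-order : ∀ {f} → IsPerm n f → OccursAll f → ∀ {x y} → x < n → y < n → clu x ≡ clu y →
      key₂ f x < key₂ f y → Φ f x < Φ f y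
    Φ-order {f} P X {x} {y} x<n y<n c p with Φ-spec P x<n | Φ-spec P y<n
    ... | u , u<n , ru , eu | v , v<n , rv , ev =
      subst₂ _<_ (sym eu) (sym ev) (reflects-< P (key₁ f) u<n v<n
        (key₁-cluster P X v<n u<n (sym cuv))
        (rank-reflects-< (key₁ f) (subst₂ _<_ (sym ru) (sym rv) (rank-< (key₂ f) x<n p))))
      where
      cuv : clu u ≡ clu v
      cuv = trans (trans (sym (clu-rank₁ P u<n)) (trans (cong clu ru) (clu-rank₂ P x<n)))
        (trans c (sym (trans (sym (clu-rank₁ P v<n)) (trans (cong clu rv) (clu-rank₂ P y<n)))))

    -- `Φ f` determines the order of `key₂ f`: across clusters it is fixed, and inside a cluster it
    -- is that of `Φ f`. This order restricted to blocks, undone by `ψ`, gives the order of `f` on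
    -- each block and so that of `key₁ f`. Thus both rankings, and with them `f`, can be recovered.
    Φ-injective : ∀ {f g} → IsPerm n f → OccursAll f → IsPerm n g → OccursAll g →
      (∀ {x} → x < n → Φ f x ≡ Φ g x) → ∀ {x} → x < n → f x ≡ g x
    Φ-injective {f} {g} Pf Xf Pg Xg eq {x} x<n = main
      where
      transfer₂ : ∀ {f g} → IsPerm n f → OccursAll f → IsPerm n g → OccursAll g →
        (∀ {x} → x < n → Φ f x ≡ Φ g x) → ∀ {x y} → x < n → y < n →
        key₂ f x < key₂ f y → key₂ g x < key₂ g y
      transfer₂ {f} {g} Pf Xf Pg Xg eq {x} {y} x<n y<n p with <-cmp (clu x) (clu y)
      ... | tri< l _ _ = key₂-clu Pg x<n l
      ... | tri> _ _ q = contradiction p (<-asym (key₂-clu Pf y<n q))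
      ... | tri≈ _ c _ with <-cmp (key₂ g x) (key₂ g y)
      ...   | tri< l _ _ = l
      ...   | tri≈ _ e _ = contradiction p (<-irrefl (cong (key₂ f) (key₂-injective Pg x<n y<n e)))
      ...   | tri> _ _ q = contradiction (Φ-order Pf Xf x<n y<n c p) (<-asym
                (subst₂ _<_ (sym (eq y<n)) (sym (eq x<n)) (Φ-order Pg Xg y<n x<n (sym c) q)))

      transfer₁ : ∀ {f g} → IsPerm n f → IsPerm n g →
        (∀ {x y} → x < n → y < n → key₂ f x < key₂ f y → key₂ g x < key₂ g y) →
        ∀ {x y} → x < n → y < n → key₁ f x < key₁ f y → key₁ g x < key₁ g y
      transfer₁ {f} {g} Pf Pg h {x} {y} x<n y<n p with <-cmp (blk x) (blk y)
      ... | tri< l _ _ = key₁-blk Pg x<n l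
      ... | tri> _ _ q = contradiction p (<-asym (key₁-blk Pf y<n q))
      ... | tri≈ _ b _ = key₁-in g b (reflects-< Pg (λ z → key₂ g (ψ z)) x<n y<n
              (back g (sym b))
              (h (ψ-bound x<n) (ψ-bound y<n) (back f b
                (reflects-< Pf (key₁ f) x<n y<n (key₁-in f (sym b)) p))))
        where
        back : ∀ f {x y} → blk x ≡ blk y → f x < f y → key₂ f (ψ x) < key₂ f (ψ y)
        back f {x} {y} b q = key₂-in f (trans (blk-ψ x) (trans b (sym (blk-ψ y))))
          (subst₂ (λ u v → f u < f v) (sym (ψ-involutive x)) (sym (ψ-involutive y)) q)

      fg₂ : ∀ {x y} → x < n → y < n → key₂ f x < key₂ f y → key₂ g x < key₂ g y
      fg₂ = transfer₂ Pf Xf Pg Xg eq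
      gf₂ : ∀ {x y} → x < n → y < n → key₂ g x < key₂ g y → key₂ f x < key₂ f y
      gf₂ = transfer₂ Pg Xg Pf Xf (λ x<n → sym (eq x<n))

      rank₁-≡ : ∀ {x} → x < n → rank₁ f x ≡ rank₁ g x
      rank₁-≡ x<n = rank-cong (key₁ f) (key₁ g)
        (λ y<n → transfer₁ Pf Pg fg₂ y<n x<n) (λ y<n → transfer₁ Pg Pf gf₂ y<n x<n)
      rank₂-≡ : ∀ {x} → x < n → rank₂ f x ≡ rank₂ g x
      rank₂-≡ x<n = rank-cong (key₂ f) (key₂ g) (λ y<n → fg₂ y<n x<n) (λ y<n → gf₂ y<n x<n)

      -- `z` is the position to which both `Φ f` and `Φ g` move the value at `x`.
      main : f x ≡ g x
      main with surjective (rank₂-perm Pf) (bounded (rank₁-perm Pf) x<n)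
      ... | z , z<n , e with Φ-spec Pf z<n | Φ-spec Pg z<n
      ...   | u , u<n , ru , eu | v , v<n , rv , ev = trans
        (cong f (injective (rank₁-perm Pf) x<n u<n (trans (sym e) (sym ru))))
        (trans (sym eu) (trans (eq z<n) (trans ev (cong g
          (injective (rank₁-perm Pg) v<n x<n
            (trans rv (trans (sym (rank₂-≡ z<n)) (trans e (rank₁-≡ x<n)))))))))

    -- Offset `a` in the window at `t` is offset `a + d` in the window at `s`, and `f` orders the
    -- shared positions in only one way.
    displacement : ∀ {f} → OccursAll f → ∀ {s t} → Mark s → Mark t → s < t → t < s + M →
      SelfOverlap M _≺_ (t ∸ s)
    displacement {f} X {s} {t} ms mt s<t t<s+M = m<n⇒0<n∸m s<t , d<M , shift
      where
      d = t ∸ s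
      s+d≡t : s + d ≡ t
      s+d≡t = m+[n∸m]≡n (<⇒≤ s<t)
      d<M : d < M
      d<M = +-cancelˡ-< s _ _ (subst (_< s + M) (sym s+d≡t) t<s+M)
      assoc : ∀ a → t + a ≡ s + (a + d)
      assoc a = trans (cong (_+ a) (sym s+d≡t)) (trans (+-assoc s d a) (cong (s +_) (+-comm d a)))
      shift : ∀ {a b} → a + d ≤ M → b + d ≤ M → a ≺ b → (a + d) ≺ (b + d)
      shift {a} {b} a+d≤M b+d≤M p with tri a+d≤M b+d≤M
      ... | inj₁ q = q
      ... | inj₂ (inj₁ e) = contradiction
        (subst (a ≺_) (sym (+-cancelʳ-≡ d a b e)) p) (irrefl (m+n≤o⇒m≤o a a+d≤M))
      ... | inj₂ (inj₂ q) = contradiction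
        (X mt (m+n≤o⇒m≤o a a+d≤M) (m+n≤o⇒m≤o b b+d≤M) p)
        (<-asym (subst₂ (λ u v → f u < f v) (sym (assoc b)) (sym (assoc a)) (X ms b+d≤M a+d≤M q)))

    -- Neighbouring windows in a block are all displaced by the same amount, since the pattern
    -- has a single nontrivial overlap. So the windows of a block lie symmetrically in it.
    reflected : ∀ {f} → OccursAll f → ∀ {x} (B : Block x) → ∀ s → Mark s → L B ≤ s → s + M ≤ H B →
      ∃[ r ] Mark r × r + (s + M) ≡ L B + H B
    reflected {f} X B = <-rec _ step
      where
      Goal : ℕ → Set
      Goal s = Mark s → L B ≤ s → s + M ≤ H B → ∃[ r ] Mark r × r + (s + M) ≡ L B + H B
      -- The mirror image of a window starting at `L B`. The position `h` just before `H B` is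
      -- interior, as `1 < M` leaves room for it; a window around `h` must end at `H B`, which is
      -- not interior.
      last-window : ∀ h → H B ≡ suc h → L B + M ≤ H B → ∃[ r ] Mark r × r + M ≡ H B
      last-window h e L+M≤H with inner B L<h h<H
        where
        h<H : h < H B
        h<H = ≤-reflexive (sym e)
        L<h : L B < h
        L<h = s<s⁻¹ (subst (suc (L B) <_) e (<-≤-trans
          (subst (_< L B + M) (+-comm (L B) 1) (+-monoʳ-< (L B) 1<M)) L+M≤H))
      ... | r , r<h , mr , h<r+M with m≤n⇒m<n∨m≡n (subst (_≤ r + M) (sym e) h<r+M)
      ...   | inj₁ H<r+M = contradiction
              (r , <-trans r<h (≤-reflexive (sym e)) , mr , H<r+M) (¬IntH B)
      ...   | inj₂ H≡r+M = r , mr , sym H≡r+M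
      step : ∀ s → (∀ {t} → t < s → Goal t) → Goal s
      step s ih ms L≤s s+M≤H with m≤n⇒m<n∨m≡n L≤s
      ... | inj₂ refl with last-window (pred (H B)) (sym (suc-pred (H B) {{>-nonZero (≤-<-trans z≤n (x<H B))}})) s+M≤H
      ...   | r , mr , e = r , mr , trans (cong (r +_) (+-comm s M))
              (trans (sym (+-assoc r M s)) (trans (cong (_+ s) e) (+-comm (H B) s)))
      step s ih ms L≤s s+M≤H | inj₁ L<s with inner B L<s (<-≤-trans (m<m+n s 0<M) s+M≤H)
      -- `s` is interior to an earlier window at `t`, whose mirror image starts at `r`. Then `r` is
      -- interior too, to a window at `q`; both displacements being the unique one, `q` is the
      -- mirror image of `s`.
      ... | t , t<s , mt , s<t+M with ih t<s mt (L≤mark B mt L<s s<t+M) (≤-trans (+-monoˡ-≤ M (<⇒≤ t<s)) s+M≤H)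
      ...   | r , mr , e with inner B L<r r<H
        where
        L<r : L B < r
        L<r with L B <? r
        ... | yes p = p
        ... | no ¬p = contradiction e (<⇒≢ (+-mono-≤-< (≮⇒≥ ¬p) (<-≤-trans (+-monoˡ-< M t<s) s+M≤H)))
        r<H : r < H B
        r<H with r <? H B
        ... | yes p = p
        ... | no ¬p = contradiction (subst (H B + L B <_) e
                (+-mono-≤-< (≮⇒≥ ¬p) (≤-<-trans (L≤mark B mt L<s s<t+M) (m<m+n t 0<M))))
                (<-irrefl (+-comm (H B) (L B)))
      ...     | q , q<r , mq , r<q+M = q , mq , trans swap e
        where
        open ≡-Reasoning
        same : s ∸ t ≡ r ∸ q
        same = unique (displacement {f} X mt ms t<s s<t+M) (displacement {f} X mq mr q<r r<q+M)
        swap : q + (s + M) ≡ r + (t + M)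
        swap = begin
          q + (s + M)             ≡⟨ cong (λ z → q + (z + M)) (sym (m+[n∸m]≡n (<⇒≤ t<s))) ⟩
          q + (t + (s ∸ t) + M)   ≡⟨ cong (λ z → q + (t + z + M)) same ⟩
          q + (t + (r ∸ q) + M)   ≡⟨ cong (λ z → q + (z + M)) (+-comm t (r ∸ q)) ⟩
          q + ((r ∸ q) + t + M)   ≡⟨ cong (q +_) (+-assoc (r ∸ q) t M) ⟩
          q + ((r ∸ q) + (t + M)) ≡⟨ +-assoc q (r ∸ q) (t + M) ⟨
          q + (r ∸ q) + (t + M)   ≡⟨ cong (_+ (t + M)) (m+[n∸m]≡n (<⇒≤ q<r)) ⟩
          r + (t + M)             ∎

    M∸-irrefl : ∀ {a b} → a ≤ M → M ∸ a ≡ M ∸ b → ¬ (M ∸ a) ≺ (M ∸ b)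
    M∸-irrefl {a} a≤M e p = irrefl (m∸n≤m M a) (subst ((M ∸ a) ≺_) (sym e) p)

    -- ψ carries the window at s onto the window at the reflected mark, read backwards.
    ψ-window : ∀ {f} → OccursAll f → ∀ {s a b} → Mark s → a ≤ M → b ≤ M →
      Int (s + a) → Int (s + b) → (M ∸ a) ≺ (M ∸ b) → f (ψ (s + a)) < f (ψ (s + b))
    ψ-window {f} X {s} {a} {b} ms a≤M b≤M ia ib p = conclude (reflected {f} X B s ms L≤s s+M≤H)
      where
      B = block ia
      L≤s : L B ≤ s
      L≤s with L B ≤? s
      ... | yes q = q
      ... | no ¬q = contradiction
        (s , ≰⇒> ¬q , ms , <-≤-trans (L<x B) (+-monoʳ-≤ s a≤M)) (¬IntL B)
      s+M≤H : s + M ≤ H B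
      s+M≤H = mark≤H B ms (m≤m+n s a) (x<H B)
      conclude : ∃[ r ] Mark r × r + (s + M) ≡ L B + H B → f (ψ (s + a)) < f (ψ (s + b))
      conclude (r , mr , e) = subst₂ (λ u v → f u < f v) (sym (image a≤M ia)) (sym (image b≤M ib))
        (X mr (m∸n≤m M a) (m∸n≤m M b) p)
        where
        image : ∀ {c} → c ≤ M → Int (s + c) → ψ (s + c) ≡ r + (M ∸ c)
        image {c} c≤M ic = +-cancelʳ-≡ (s + c) _ _ (begin
          ψ (s + c) + (s + c)      ≡⟨ ψ-Block (move B L<s+c s+c<H) ⟩
          L B + H B                ≡⟨ sym e ⟩
          r + (s + M)              ≡⟨ cong (λ z → r + (s + z)) (sym (m∸n+n≡m c≤M)) ⟩
          r + (s + (M ∸ c + c))    ≡⟨ cong (r +_) (trans (sym (+-assoc s (M ∸ c) c))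
                                        (trans (cong (_+ c) (+-comm s (M ∸ c))) (+-assoc (M ∸ c) s c))) ⟩
          r + (M ∸ c + (s + c))    ≡⟨ sym (+-assoc r (M ∸ c) (s + c)) ⟩
          r + (M ∸ c) + (s + c)    ∎)
          where
          open ≡-Reasoning
          L<s+c : L B < s + c
          L<s+c = ≤∧≢⇒< (≤-trans L≤s (m≤m+n s c)) (λ q → ¬IntL B (subst Int (sym q) ic))
          s+c<H : s + c < H B
          s+c<H = ≤∧≢⇒< (≤-trans (+-monoʳ-≤ s c≤M) s+M≤H) (λ q → ¬IntH B (subst Int q ic))

    -- If `s + a` is in a later block, the reversed block order gives the claim; in a common block
    -- the reflection does. If it is in an earlier block, a break lies between; a break in a window
    -- is one of its ends, so `a ≡ 0` or `b ≡ M`, against the maximality of `M` or the minimality of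
    -- `0`.
    key₂-window : ∀ {f} → IsPerm n f → OccursAll f → ∀ {s a b} → Mark s → a ≤ M → b ≤ M →
      (M ∸ a) ≺ (M ∸ b) → key₂ f (s + a) < key₂ f (s + b)
    key₂-window {f} P X {s} {a} {b} ms a≤M b≤M p
      with <-cmp (blk (s + a)) (blk (s + b))
    ... | tri> _ _ g = key₂-blk P (≤-<-trans (+-monoʳ-≤ s a≤M) (bnd ms))
            (trans (sym (clu-window ms a≤M)) (clu-window ms b≤M)) g
    ... | tri≈ _ e _ = key₂-in f e (ψ-window {f} X ms a≤M b≤M (proj₁ ints) (proj₂ ints) p)
      where
      ints : Int (s + a) × Int (s + b)
      ints with <-cmp (s + a) (s + b)
      ... | tri< l _ _ = blk≡⇒Int e ≤-refl (<⇒≤ l) l , blk≡⇒Int e (<⇒≤ l) ≤-refl l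
      ... | tri> _ _ l = blk≡⇒Int (sym e) (<⇒≤ l) ≤-refl l , blk≡⇒Int (sym e) ≤-refl (<⇒≤ l) l
      ... | tri≈ _ q _ = contradiction p (M∸-irrefl {b = b} a≤M (cong (M ∸_) (+-cancelˡ-≡ s a b q)))
    ... | tri< l _ _ with s + a ≤? s + b
    ...   | no ¬q = contradiction l (≤⇒≯ (Blk.label-mono (<⇒≤ (≰⇒> ¬q))))
    ...   | yes s+a≤s+b with break s+a≤s+b (<⇒≢ l)
    ...     | t , s+a≤t , t≤s+b , ¬i with m≤n⇒m<n∨m≡n (≤-trans (m≤m+n s a) s+a≤t)
    ...       | inj₂ refl = contradiction p (first a≡0)
      where
      a≡0 : a ≡ 0
      a≡0 = n≤0⇒n≡0 (+-cancelˡ-≤ s a 0 (≤-trans s+a≤t (≤-reflexive (sym (+-identityʳ s)))))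
      first : a ≡ 0 → ¬ (M ∸ a) ≺ (M ∸ b)
      first refl q with m≤n⇒m<n∨m≡n (m∸n≤m M b)
      ... | inj₁ r = asym ≤-refl (m∸n≤m M b) q (max r)
      ... | inj₂ r = irrefl ≤-refl (subst (M ≺_) r q)
    ...       | inj₁ s<t with t <? s + M
    ...         | yes t<s+M = contradiction (s , s<t , ms , t<s+M) ¬i
    ...         | no ¬t<s+M = contradiction p (second b≡M)
      where
      b≡M : b ≡ M
      b≡M = ≤-antisym b≤M (+-cancelˡ-≤ s M b (≤-trans (≮⇒≥ ¬t<s+M) t≤s+b))
      second : b ≡ M → ¬ (M ∸ a) ≺ (M ∸ b)
      second refl q with subst ((M ∸ a) ≺_) (n∸n≡0 M) q | m≤n⇒m<n∨m≡n (z≤n {M ∸ a})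
      ... | q′ | inj₁ r = asym z≤n (m∸n≤m M a) (min r (m∸n≤m M a)) q′
      ... | q′ | inj₂ r = irrefl z≤n (subst (_≺ 0) (sym r) q′)

    Φ-occurs : ∀ {f} → IsPerm n f → OccursAll f → ∀ {s} → Mark s → Occurs M (Reversed M _≺_) (Φ f) s
    Φ-occurs {f} P X {s} ms {a} {b} a≤M b≤M p = Φ-order P X
      (≤-<-trans (+-monoʳ-≤ s a≤M) (bnd ms)) (≤-<-trans (+-monoʳ-≤ s b≤M) (bnd ms))
      (trans (sym (clu-window ms a≤M)) (clu-window ms b≤M))
      (key₂-window P X ms a≤M b≤M p)

-- Permutations as functions on ℕ

abstract
  -- Extended by the junk value 0.
  ext : ∀ {n} → (Fin n → Fin n) → ℕ → ℕ
  ext {n} σ x with x <? n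
  ... | yes x<n = toℕ (σ (fromℕ< x<n))
  ... | no  _   = 0

  ext-< : ∀ {n} (σ : Fin n → Fin n) {x} (x<n : x < n) → ext σ x ≡ toℕ (σ (fromℕ< x<n))
  ext-< {n} σ {x} x<n with x <? n
  ... | yes p = refl
  ... | no ¬p = contradiction x<n ¬p

  ext-toℕ : ∀ {n} (σ : Fin n → Fin n) i → ext σ (toℕ i) ≡ toℕ (σ i)
  ext-toℕ σ i = trans (ext-< σ (toℕ<n i)) (cong (toℕ ∘ σ) (fromℕ<-toℕ i (toℕ<n i)))

  ext-cong : ∀ {n} {σ τ : Fin n → Fin n} → (∀ i → σ i ≡ τ i) → ∀ x → ext σ x ≡ ext τ x
  ext-cong {n} e x with x <? n
  ... | yes x<n = cong toℕ (e (fromℕ< x<n))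
  ... | no  _   = refl

fun : ∀ {n} → Permutation′ n → ℕ → ℕ
fun σ = ext (σ ⟨$⟩ʳ_)

fun-perm : ∀ {n} (σ : Permutation′ n) → IsPerm n (fun σ)
fun-perm {n} σ = record
  { bounded   = λ x<n → subst (_< n) (sym (ext-< _ x<n)) (toℕ<n _)
  ; injective = λ {x} {y} x<n y<n e → Fin.fromℕ<-injective x y x<n y<n
      (trans (sym (Perm.inverseˡ σ)) (trans
        (cong (σ ⟨$⟩ˡ_) (toℕ-injective (trans (sym (ext-< _ x<n)) (trans e (ext-< _ y<n)))))
        (Perm.inverseˡ σ)))
  }

module _ {n} {f : ℕ → ℕ} (P : IsPerm n f) where
  open IsPerm P

  toPerm : Permutation′ n
  toPerm = permutation to from
    (λ j → toℕ-injective (trans (toℕ-fromℕ< _)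
      (trans (cong f (toℕ-fromℕ< _)) (proj₂ (proj₂ (surjective (toℕ<n j)))))))
    (λ i → toℕ-injective (trans (toℕ-fromℕ< _)
      (injective (proj₁ (proj₂ (surjective (toℕ<n (to i))))) (toℕ<n i)
        (trans (proj₂ (proj₂ (surjective (toℕ<n (to i))))) (toℕ-fromℕ< _)))))
    where
    to from : Fin n → Fin n
    to i   = fromℕ< (bounded (toℕ<n i))
    from j = fromℕ< (proj₁ (proj₂ (surjective (toℕ<n j))))

  toℕ-toPerm : ∀ i → toℕ (toPerm ⟨$⟩ʳ i) ≡ f (toℕ i)
  toℕ-toPerm i = toℕ-fromℕ< _

  fun-toPerm : ∀ {x} → x < n → fun toPerm x ≡ f x
  fun-toPerm {x} x<n = trans (ext-< _ x<n) (trans (toℕ-toPerm _) (cong f (toℕ-fromℕ< x<n)))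

fun-injective : ∀ {n} (σ τ : Permutation′ n) → (∀ {x} → x < n → fun σ x ≡ fun τ x) → σ ≈ τ
fun-injective σ τ e i = toℕ-injective (trans (sym (ext-toℕ _ i)) (trans (e (toℕ<n i)) (ext-toℕ _ i)))

-- Standardization

tabulate-applyUpTo : ∀ {A : Set} n (f : ℕ → A) → tabulate {n = n} (f ∘ toℕ) ≡ applyUpTo f n
tabulate-applyUpTo zero    f = refl
tabulate-applyUpTo (suc n) f = cong (f 0 ∷_) (tabulate-applyUpTo n (f ∘ suc))

applyUpTo-cong : ∀ {A : Set} n {f g : ℕ → A} → (∀ {x} → x < n → f x ≡ g x) → applyUpTo f n ≡ applyUpTo g n
applyUpTo-cong zero    e = refl
applyUpTo-cong (suc n) e = cong₂ _∷_ (e z<s) (applyUpTo-cong n (e ∘ s<s))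

applyUpTo-injective : ∀ {A : Set} n {f g : ℕ → A} → applyUpTo f n ≡ applyUpTo g n → ∀ {x} → x < n → f x ≡ g x
applyUpTo-injective (suc n) e {zero}  _   = proj₁ (∷-injective e)
applyUpTo-injective (suc n) e {suc x} x<n = applyUpTo-injective n (proj₂ (∷-injective e)) (s<s⁻¹ x<n)

drop-applyUpTo : ∀ {A : Set} d n (f : ℕ → A) → drop d (applyUpTo f n) ≡ applyUpTo (λ x → f (d + x)) (n ∸ d)
drop-applyUpTo zero    n       f = refl
drop-applyUpTo (suc d) zero    f = refl
drop-applyUpTo (suc d) (suc n) f = drop-applyUpTo d n (f ∘ suc)

take-applyUpTo : ∀ {A : Set} {m n} (f : ℕ → A) → m ≤ n → take m (applyUpTo f n) ≡ applyUpTo f m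
take-applyUpTo f z≤n     = refl
take-applyUpTo f (s≤s p) = cong (f 0 ∷_) (take-applyUpTo (f ∘ suc) p)

last-applyUpTo : ∀ {A : Set} n (f : ℕ → A) → last (applyUpTo f (suc n)) ≡ just (f n)
last-applyUpTo zero    f = refl
last-applyUpTo (suc n) f = last-applyUpTo n (f ∘ suc)

filter-applyUpTo : ∀ {P : Pred ℕ 0ℓ} (P? : Decidable P) n f →
  length (filter P? (applyUpTo f n)) ≡ count {n = n} (λ i → P? (f (toℕ i)))
filter-applyUpTo P? zero    f = refl
filter-applyUpTo P? (suc n) f with P? (f 0)
... | yes _ = cong suc (filter-applyUpTo P? n (f ∘ suc))
... | no  _ = filter-applyUpTo P? n (f ∘ suc)

module Standard (n : ℕ) where

  abstract
    std : (ℕ → ℕ) → ℕ → ℕ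
    std w x = count {n = n} (λ i → w (toℕ i) ≤? w x)

    st-applyUpTo : ∀ w → st (applyUpTo w n) ≡ applyUpTo (std w) n
    st-applyUpTo w = trans (map-applyUpTo w _ n)
      (applyUpTo-cong n (λ {x} _ → filter-applyUpTo (_≤? w x) n w))

    std-≤ : ∀ w {x y} → w x ≤ w y → std w x ≤ std w y
    std-≤ w {x} {y} p = count-mono {n = n} (λ i → w (toℕ i) ≤? w x) (λ i → w (toℕ i) ≤? w y)
      (λ _ q → ≤-trans q p)

    std-< : ∀ w {x y} → y < n → w x < w y → std w x < std w y
    std-< w {x} {y} y<n p = count-strict {n = n} (λ i → w (toℕ i) ≤? w x) (λ i → w (toℕ i) ≤? w y)
      (λ _ q → ≤-trans q (<⇒≤ p)) (fromℕ< y<n)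
      (<⇒≱ (subst (λ z → w x < w z) (sym (toℕ-fromℕ< y<n)) p))
      (≤-reflexive (cong w (toℕ-fromℕ< y<n)))

    std-bound : ∀ w x → std w x ≤ n
    std-bound w x = ≤-trans
      (count-mono {n = n} (λ i → w (toℕ i) ≤? w x) (λ i → toℕ i <? n) (λ i _ → toℕ<n i))
      (≤-reflexive (count-< n ≤-refl))

    0<std : ∀ w {x} → x < n → 0 < std w x
    0<std w {x} x<n = ≤-<-trans z≤n
      (count-strict {n = n} (λ i → toℕ i <? 0) (λ i → w (toℕ i) ≤? w x) (λ _ ())
      (fromℕ< x<n) (λ ()) (≤-reflexive (cong w (toℕ-fromℕ< x<n))))

    -- Preservation of strict order in one direction is enough: `v` has no ties, and the
    -- contrapositive gives the other direction.
    std-cong : ∀ v w → (∀ {x y} → x < n → y < n → v x ≡ v y → x ≡ y) →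
      (∀ {x y} → x < n → y < n → v x < v y → w x < w y) → ∀ {x} → x < n → std v x ≡ std w x
    std-cong v w v-inj h {x} x<n = count-cong {n = n} (λ i → v (toℕ i) ≤? v x) (λ i → w (toℕ i) ≤? w x)
      to from
      where
      to : ∀ (i : Fin n) → v (toℕ i) ≤ v x → w (toℕ i) ≤ w x
      to i p with m≤n⇒m<n∨m≡n p
      ... | inj₁ l = <⇒≤ (h (toℕ<n i) x<n l)
      ... | inj₂ e = ≤-reflexive (cong w (v-inj (toℕ<n i) x<n e))
      from : ∀ (i : Fin n) → w (toℕ i) ≤ w x → v (toℕ i) ≤ v x
      from i p = ≮⇒≥ (λ l → <⇒≱ (h x<n (toℕ<n i) l) p)

  std-reflects-< : ∀ w {x y} → std w x < std w y → w x < w y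
  std-reflects-< w p = ≰⇒> (λ q → <⇒≱ p (std-≤ w q))

  -- Along increasing values, std (suc ∘ f) is strictly increasing from [0,n) to [1,n].
  std-perm : ∀ {f} → IsPerm n f → ∀ {x} → x < n → std (suc ∘ f) x ≡ suc (f x)
  std-perm {f} P {x} x<n = ≤-antisym
    (+-cancelʳ-≤ k _ _ (≤-trans (upper k x<n refl (trans (+-suc (f x) k) (m+[n∸m]≡n (bounded x<n))))
      (≤-reflexive (sym (m+[n∸m]≡n (bounded x<n))))))
    (lower (f x) x<n refl)
    where
    open IsPerm P
    k = n ∸ suc (f x)
    step : ∀ {x y} → y < n → suc (f x) ≡ f y → std (suc ∘ f) x < std (suc ∘ f) y
    step y<n e = std-< (suc ∘ f) y<n (s<s (≤-reflexive e))
    lower : ∀ v {x} → x < n → f x ≡ v → suc v ≤ std (suc ∘ f) x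
    lower zero    x<n e = 0<std (suc ∘ f) x<n
    lower (suc v) x<n e with surjective (<-trans (≤-reflexive (sym e)) (bounded x<n))
    ... | y , y<n , e′ = ≤-trans (s≤s (lower v y<n e′)) (step x<n (trans (cong suc e′) (sym e)))
    upper : ∀ k {x v} → x < n → f x ≡ v → v + suc k ≡ n → std (suc ∘ f) x + k ≤ n
    upper zero    {x} x<n e q = ≤-trans (≤-reflexive (+-identityʳ _)) (std-bound (suc ∘ f) x)
    upper (suc k) {x} {v} x<n e q with surjective {suc v} (subst (suc (suc v) ≤_) q′ (m≤m+n _ k))
      where
      q′ : suc (suc v) + k ≡ n
      q′ = trans (sym (trans (+-suc v (suc k)) (cong suc (+-suc v k)))) q
    ... | y , y<n , e′ = ≤-trans
      (≤-trans (≤-reflexive (+-suc _ k)) (+-monoˡ-≤ k (step y<n (trans (cong suc e) (sym e′)))))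
      (upper k y<n e′ (trans (sym (+-suc v (suc k))) q))

-- Em and Overlap in terms of order

word-applyUpTo : ∀ {n} (σ : Permutation′ n) → word σ ≡ applyUpTo (suc ∘ fun σ) n
word-applyUpTo {n} σ = trans (tabulate-cong (λ i → cong suc (sym (ext-toℕ _ i))))
  (tabulate-applyUpTo n (suc ∘ fun σ))

Pat : ∀ {m} → Permutation′ m → ℕ → ℕ → Set
Pat π a b = fun π a < fun π b

module _ {M n : ℕ} (π : Permutation′ (suc M)) (σ : Permutation′ n) where
  open Standard (suc M)

  window : ∀ {s} → s + M < n →
    take (suc M) (drop s (word σ)) ≡ applyUpTo (λ a → suc (fun σ (s + a))) (suc M)
  window {s} s+M<n = trans (cong (take (suc M) ∘ drop s) (word-applyUpTo σ))
    (trans (cong (take (suc M)) (drop-applyUpTo s n (suc ∘ fun σ)))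
      (take-applyUpTo _ (m+n≤o⇒m≤o∸n (suc M) (subst (_≤ n) (cong suc (+-comm s M)) s+M<n))))

  Em⇒< : ∀ {s} → Em π σ (suc s) → s + M < n
  Em⇒< {s} (_ , le , _) = s≤s⁻¹ (subst₂ _≤_ (cong suc (+-suc s M)) (+-comm n 1) le)

  Em⇒Occurs : ∀ {s} → Em π σ (suc s) → Occurs M (Pat π) (fun σ) s
  Em⇒Occurs {s} em@(_ , _ , e) {a} {b} a≤M b≤M p = s<s⁻¹ (std-reflects-< w
    (subst₂ _<_ (sym (at (s≤s a≤M))) (sym (at (s≤s b≤M))) (s<s p)))
    where
    w : ℕ → ℕ
    w a = suc (fun σ (s + a))
    at : ∀ {x} → x < suc M → std w x ≡ suc (fun π x)
    at = applyUpTo-injective (suc M) {std w} {suc ∘ fun π} (trans (sym (st-applyUpTo w))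
      (trans (cong st (sym (window (Em⇒< em)))) (trans e (word-applyUpTo π))))

  -- A window ordered like `π` has the standardization of `word π`, which by `std-perm` is `word π`
  -- itself.
  Occurs⇒Em : ∀ {s} → s + M < n → Occurs M (Pat π) (fun σ) s → Em π σ (suc s)
  Occurs⇒Em {s} s+M<n occ = s≤s z≤n ,
    subst₂ _≤_ (cong suc (sym (+-suc s M))) (+-comm 1 n) (s≤s s+M<n) ,
    trans (cong st (window s+M<n)) (trans (st-applyUpTo w)
      (trans (applyUpTo-cong (suc M) at) (sym (word-applyUpTo π))))
    where
    w : ℕ → ℕ
    w a = suc (fun σ (s + a))
    at : ∀ {x} → x < suc M → std w x ≡ suc (fun π x)
    at x<m = trans (sym (std-cong (suc ∘ fun π) w
      (λ x<m y<m e → IsPerm.injective (fun-perm π) x<m y<m (suc-injective e))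
      (λ x<m y<m p → s<s (occ (s≤s⁻¹ x<m) (s≤s⁻¹ y<m) (s<s⁻¹ p))) x<m))
      (std-perm (fun-perm π) x<m)

shift⇒Overlap : ∀ {M} (π : Permutation′ (suc M)) {d} → 0 < d → d ≤ M →
  (∀ {a b} → a + d ≤ M → b + d ≤ M → Pat π a b → Pat π (a + d) (b + d)) → Overlap π d
shift⇒Overlap {M} π {d} 0<d d≤M shift = 0<d , s≤s d≤M , (begin
  st (drop d (word π))                 ≡⟨ cong (st ∘ drop d) (word-applyUpTo π) ⟩
  st (drop d (applyUpTo p (suc M)))    ≡⟨ cong st (drop-applyUpTo d (suc M) p) ⟩
  st (applyUpTo (λ x → p (d + x)) l)   ≡⟨ st-applyUpTo _ ⟩
  applyUpTo (std (λ x → p (d + x))) l  ≡⟨ applyUpTo-cong l (λ x<l → sym (std-cong p (λ x → p (d + x)) inj mono x<l)) ⟩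
  applyUpTo (std p) l                  ≡⟨ st-applyUpTo p ⟨
  st (applyUpTo p l)                   ≡⟨ cong st (take-applyUpTo p (m∸n≤m (suc M) d)) ⟨
  st (take l (applyUpTo p (suc M)))    ≡⟨ cong (st ∘ take l) (word-applyUpTo π) ⟨
  st (take l (word π))                 ∎)
  where
  open ≡-Reasoning
  p : ℕ → ℕ
  p = suc ∘ fun π
  l = suc M ∸ d
  open Standard l
  inj : ∀ {x y} → x < l → y < l → p x ≡ p y → x ≡ y
  inj x<l y<l e = IsPerm.injective (fun-perm π) (<-≤-trans x<l (m∸n≤m (suc M) d))
    (<-≤-trans y<l (m∸n≤m (suc M) d)) (suc-injective e)
  fits : ∀ {x} → x < l → x + d ≤ M
  fits {x} x<l = s≤s⁻¹ (≤-trans (+-monoˡ-≤ d x<l) (≤-reflexive (m∸n+n≡m (m≤n⇒m≤1+n d≤M))))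
  mono : ∀ {x y} → x < l → y < l → p x < p y → p (d + x) < p (d + y)
  mono {x} {y} x<l y<l q = subst₂ (λ u v → p u < p v) (+-comm x d) (+-comm y d)
    (s<s (shift (fits x<l) (fits y<l) (s<s⁻¹ q)))

fun-reverse : ∀ {M} (π : Permutation′ (suc M)) {a} → a ≤ M → fun (π ᴿ) a ≡ fun π (M ∸ a)
fun-reverse {M} π {a} a≤M = trans (ext-< _ (s≤s a≤M)) (sym (trans
  (cong (fun π) (sym (trans (opposite-prop (fromℕ< (s≤s a≤M))) (cong (λ z → suc M ∸ suc z) (toℕ-fromℕ< (s≤s a≤M))))))
  (ext-toℕ _ (opposite (fromℕ< (s≤s a≤M))))))

good : ∀ {M} (π : Permutation′ (suc M)) → head (word π) ≡ just 1 → last (word π) ≡ just (suc M) →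
  HasSize (setoid ℕ) (Overlap π) 2 → Good M (Pat π)
good {M} π hd lst size = record
  { 1<M    = 1<M
  ; tri    = λ {a} {b} a≤M b≤M → tri a≤M b≤M
  ; asym   = λ _ _ → <-asym
  ; min    = λ {a} 0<a a≤M → subst (_< fun π a) (sym first)
      (n≢0⇒n>0 (λ e → <⇒≢ 0<a (injective z<s (s≤s a≤M) (trans first (sym e)))))
  ; max    = λ {a} a<M → subst (fun π a <_) (sym final)
      (≤∧≢⇒< (s≤s⁻¹ (bounded (m<n⇒m<1+n a<M))) (λ e → <⇒≢ a<M (injective (m<n⇒m<1+n a<M) ≤-refl (trans e (sym final)))))
  ; unique = unique
  }
  where
  open IsPerm (fun-perm π)
  open Inverse size using (to; from) renaming (inverseˡ to to-from; inverseʳ to from-to)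
  first : fun π 0 ≡ 0
  first = suc-injective (just-injective (trans (sym (cong head (word-applyUpTo π))) hd))
  final : fun π M ≡ M
  final = suc-injective (just-injective
    (trans (sym (last-applyUpTo M (suc ∘ fun π))) (trans (sym (cong last (word-applyUpTo π))) lst)))
  tri : ∀ {a b} → a ≤ M → b ≤ M → Pat π a b ⊎ a ≡ b ⊎ Pat π b a
  tri {a} {b} a≤M b≤M with <-cmp (fun π a) (fun π b)
  ... | tri< l _ _ = inj₁ l
  ... | tri≈ _ e _ = inj₂ (inj₁ (injective (s≤s a≤M) (s≤s b≤M) e))
  ... | tri> _ _ g = inj₂ (inj₂ g)
  from-injective : ∀ x y → from x ≡ from y → proj₁ x ≡ proj₁ y
  from-injective x y e = trans (sym (to-from {x = x} refl))
    (trans (cong (proj₁ ∘ to) e) (to-from {x = y} refl))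
  -- With `M ≤ 1` every overlap would be 1, whereas there are two different ones.
  1<M : 1 < M
  1<M = ≰⇒> (λ M≤1 → Fin.0≢1+n (trans (sym (from-to {x = zero} {y = to zero} refl))
    (from-to {x = suc zero} {y = to zero} (trans (only M≤1 (to zero)) (sym (only M≤1 (to (suc zero))))))))
    where
    only : M ≤ 1 → ∀ x → proj₁ x ≡ 1
    only M≤1 (x , 0<x , x<m , _) = ≤-antisym (≤-trans (s≤s⁻¹ x<m) M≤1) 0<x
  two : ∀ {a b c : Fin 2} → a ≢ c → b ≢ c → a ≡ b
  two {zero}     {zero}     _ _ = refl
  two {suc zero} {suc zero} _ _ = refl
  two {zero}     {suc zero} {zero}     p q = contradiction refl p
  two {zero}     {suc zero} {suc zero} p q = contradiction refl q
  two {suc zero} {zero}     {zero}     p q = contradiction refl q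
  two {suc zero} {zero}     {suc zero} p q = contradiction refl p
  -- Only one letter is compared, so `a` and `b` are both 0 and `Pat π a b` is absurd.
  trivial : 0 < M → Overlap π M
  trivial 0<M = shift⇒Overlap π 0<M ≤-refl (λ {a} {b} p q r → contradiction r
    (<-irrefl (cong (fun π) (trans (zero-sum p) (sym (zero-sum q))))))
    where
    zero-sum : ∀ {a} → a + M ≤ M → a ≡ 0
    zero-sum p = n≤0⇒n≡0 (+-cancelʳ-≤ M _ 0 p)
  -- `M` is one of the two overlaps; `d` and `e` differ from it, so both are the other one.
  unique : ∀ {d e} → SelfOverlap M (Pat π) d → SelfOverlap M (Pat π) e → d ≡ e
  unique {d} {e} (0<d , d<M , sd) (0<e , e<M , se) = from-injective od oe
    (two {c = from om} (<⇒≢ d<M ∘ from-injective od om) (<⇒≢ e<M ∘ from-injective oe om))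
    where
    od = d , shift⇒Overlap π 0<d (<⇒≤ d<M) sd
    oe = e , shift⇒Overlap π 0<e (<⇒≤ e<M) se
    om = M , trivial (<-trans 0<d d<M)

-- Injections between sets of permutations with prescribed occurrences

record Embedding (n : ℕ) (M : ℕ) (Mark : Pred ℕ 0ℓ) (R S : ℕ → ℕ → Set) : Set where
  field
    map-to    : (ℕ → ℕ) → ℕ → ℕ
    perm      : ∀ {f} → IsPerm n f → IsPerm n (map-to f)
    occurs    : ∀ {f} → IsPerm n f → (∀ {s} → Mark s → Occurs M R f s) →
                ∀ {s} → Mark s → Occurs M S (map-to f) s
    injective : ∀ {f g} → IsPerm n f → (∀ {s} → Mark s → Occurs M R f s) →
                IsPerm n g → (∀ {s} → Mark s → Occurs M R g s) →
                (∀ {x} → x < n → map-to f x ≡ map-to g x) → ∀ {x} → x < n → f x ≡ g x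

complement : ℕ → (ℕ → ℕ) → ℕ → ℕ
complement n f x = n ∸ suc (f x)

∸-suc-injective : ∀ {n a b} → a < n → b < n → n ∸ suc a ≡ n ∸ suc b → a ≡ b
∸-suc-injective a<n b<n e = suc-injective (∸-cancelˡ-≡ a<n b<n e)

complement-perm : ∀ {n f} → IsPerm n f → IsPerm n (complement n f)
complement-perm {n} {f} P = record
  { bounded   = λ {x} x<n → ∸-monoʳ-< {n} {suc (f x)} {0} z<s (IsPerm.bounded P x<n)
  ; injective = λ x<n y<n e → IsPerm.injective P x<n y<n
      (∸-suc-injective (IsPerm.bounded P x<n) (IsPerm.bounded P y<n) e)
  }

module _ {n M : ℕ} {Mark : Pred ℕ 0ℓ} (bnd : ∀ {s} → Mark s → s + M < n) where

  complement-occurs : ∀ {R f} → IsPerm n f → (∀ {s} → Mark s → Occurs M R f s) →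
    ∀ {s} → Mark s → Occurs M (flip R) (complement n f) s
  complement-occurs {R} {f} P X {s} ms {a} {b} a≤M b≤M p =
    ∸-monoʳ-< (s<s (X ms b≤M a≤M p)) (IsPerm.bounded P (≤-<-trans (+-monoʳ-≤ s a≤M) (bnd ms)))

  -- Conjugation by complementation, which turns occurrences of a pattern into occurrences of its
  -- complement.
  embed-flip : ∀ {R S} → Embedding n M Mark R S → Embedding n M Mark (flip R) (flip S)
  embed-flip {R} {S} E = record
    { map-to    = complement n ∘ E.map-to ∘ complement n
    ; perm      = λ P → complement-perm (E.perm (complement-perm P))
    ; occurs    = λ {f} P X → complement-occurs {S} {E.map-to (complement n f)} (E.perm (complement-perm P))
        (E.occurs (complement-perm P) (complement-occurs {flip R} {f} P X))
    ; injective = λ {f} {g} Pf Xf Pg Xg e x<n → ∸-suc-injective (IsPerm.bounded Pf x<n) (IsPerm.bounded Pg x<n)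
        (E.injective (complement-perm Pf) (complement-occurs {flip R} {f} Pf Xf)
          (complement-perm Pg) (complement-occurs {flip R} {g} Pg Xg)
          (λ y<n → ∸-suc-injective (IsPerm.bounded (E.perm (complement-perm Pf)) y<n)
            (IsPerm.bounded (E.perm (complement-perm Pg)) y<n) (e y<n)) x<n)
    }
    where module E = Embedding E

  embed-reversed : Decidable Mark → ∀ {R} → Good M R → Embedding n M Mark R (Reversed M R)
  embed-reversed Mark? {R} good = record
    { map-to    = C.Φ
    ; perm      = C.Φ-perm
    ; occurs    = C.Pattern.Φ-occurs R good
    ; injective = C.Pattern.Φ-injective R good
    }
    where module C = Core n M (Good.0<M good) Mark? bnd

good-reverse-complement : ∀ {M R} → Good M R → Good M (flip (Reversed M R))
good-reverse-complement {M} {R} good = record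
  { 1<M    = 1<M
  ; tri    = λ {a} {b} a≤M b≤M → tri′ a≤M b≤M
  ; asym   = λ {a} {b} _ _ p q → asym (m∸n≤m M b) (m∸n≤m M a) p q
  ; min    = λ {a} 0<a a≤M → max (∸-monoʳ-< 0<a a≤M)
  ; max    = λ {a} a<M → subst (λ z → R z (M ∸ a)) (sym (n∸n≡0 M)) (min (m<n⇒0<n∸m a<M) (m∸n≤m M a))
  ; unique = λ p q → unique (back p) (back q)
  }
  where
  open Good good
  tri′ : ∀ {a b} → a ≤ M → b ≤ M → R (M ∸ b) (M ∸ a) ⊎ a ≡ b ⊎ R (M ∸ a) (M ∸ b)
  tri′ {a} {b} a≤M b≤M with tri (m∸n≤m M b) (m∸n≤m M a)
  ... | inj₁ p = inj₁ p
  ... | inj₂ (inj₁ e) = inj₂ (inj₁ (sym (∸-cancelˡ-≡ b≤M a≤M e)))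
  ... | inj₂ (inj₂ p) = inj₂ (inj₂ p)
  -- Reading from the other end swaps the overlapping prefix and suffix, so the shift yields the
  -- converse implication, from `R (b + d) (a + d)` to `R b a`; totality turns it around.
  back : ∀ {d} → SelfOverlap M (flip (Reversed M R)) d → SelfOverlap M R d
  back {d} (0<d , d<M , shift) = 0<d , d<M , shift′
    where
    at : ∀ a → a + d ≤ M → M ∸ (a + d) + d ≤ M
    at a p = ≤-trans (+-monoʳ-≤ (M ∸ (a + d)) (m≤n+m d a)) (≤-reflexive (m∸n+n≡m p))
    low : ∀ a → a + d ≤ M → M ∸ (M ∸ (a + d)) ≡ a + d
    low a p = m∸[m∸n]≡n p
    high : ∀ a → a + d ≤ M → M ∸ (M ∸ (a + d) + d) ≡ a
    high a p = trans (cong (M ∸_) (trans (+-comm _ d) (trans (cong (d +_) (trans (cong (M ∸_) (+-comm a d)) (sym (∸-+-assoc M d a))))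
      (m+[n∸m]≡n′)))) (m∸[m∸n]≡n (m+n≤o⇒m≤o a p))
      where
      m+[n∸m]≡n′ : d + (M ∸ d ∸ a) ≡ M ∸ a
      m+[n∸m]≡n′ = trans (sym (+-∸-assoc d (m+n≤o⇒m≤o∸n a p))) (cong (_∸ a) (m+[n∸m]≡n (m+n≤o⇒n≤o a p)))
    shift′ : ∀ {a b} → a + d ≤ M → b + d ≤ M → R a b → R (a + d) (b + d)
    shift′ {a} {b} p q r with tri p q
    ... | inj₁ t = t
    ... | inj₂ (inj₁ e) = contradiction (subst (R a) (sym (+-cancelʳ-≡ d a b e)) r) (irrefl (m+n≤o⇒m≤o a p))
    ... | inj₂ (inj₂ t) = contradiction r (asym (m+n≤o⇒m≤o b q) (m+n≤o⇒m≤o a p)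
      (subst₂ R (high b q) (high a p) (shift (at a p) (at b q) (subst₂ R (sym (low b q)) (sym (low a p)) t))))

-- The reversal of the reverse complement is the complement. Flipping both sides therefore leads
-- from the reversed pattern back to `R`, up to `M ∸ (M ∸ a) ≡ a`.
embed-back : ∀ {n M Mark} → (∀ {s} → Mark s → s + M < n) → Decidable Mark → ∀ {R} → Good M R →
  Embedding n M Mark (Reversed M R) R
embed-back {n} {M} {Mark} bnd Mark? {R} good = record
  { map-to    = E.map-to
  ; perm      = E.perm
  ; occurs    = λ {f} P X {s} ms {a} {b} a≤M b≤M p → E.occurs P X ms a≤M b≤M
      (subst₂ R (sym (m∸[m∸n]≡n a≤M)) (sym (m∸[m∸n]≡n b≤M)) p)
  ; injective = E.injective
  }
  where module E = Embedding (embed-flip bnd (embed-reversed bnd Mark? (good-reverse-complement good)))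

-- Sizes of decidable sets of permutations

count-split : ∀ {n} {P Q R : Pred (Fin n) 0ℓ} (P? : Decidable P) (Q? : Decidable Q) (R? : Decidable R) →
  (∀ i → P i → Q i ⊎ R i) → (∀ i → Q i → P i) → (∀ i → R i → P i) → (∀ i → Q i → ¬ R i) →
  count P? ≡ count Q? + count R?
count-split {zero} P? Q? R? f g h k = refl
count-split {suc n} P? Q? R? f g h k
  with P? zero | Q? zero | R? zero | count-split (P? ∘ suc) (Q? ∘ suc) (R? ∘ suc) (f ∘ suc) (g ∘ suc) (h ∘ suc) (k ∘ suc)
... | yes p | yes q | yes r | ih = contradiction r (k zero q)
... | yes p | yes q | no ¬r | ih = cong suc ih
... | yes p | no ¬q | yes r | ih = trans (cong suc ih) (sym (+-suc _ _))
... | no ¬p | yes q | _     | ih = contradiction (g zero q) ¬p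
... | no ¬p | no ¬q | yes r | ih = contradiction (h zero r) ¬p
... | no ¬p | no ¬q | no ¬r | ih = ih
... | yes p | no ¬q | no ¬r | ih with f zero p
...   | inj₁ q = contradiction q ¬q
...   | inj₂ r = contradiction r ¬r

module _ {a ℓ p} (A : Setoid a ℓ) {P : Pred (Setoid.Carrier A) p} where
  private module A = Setoid A

  enumeration⇒HasSize : ∀ {k} (e : Fin k → Σ A.Carrier P) →
    (∀ {i j} → proj₁ (e i) A.≈ proj₁ (e j) → i ≡ j) →
    (∀ x → P x → ∃[ i ] proj₁ (e i) A.≈ x) → HasSize A P k
  enumeration⇒HasSize e inj surj = record
    { to        = e
    ; from      = index
    ; to-cong   = λ { refl → A.refl }
    ; from-cong = λ {x} {y} q → inj (A.trans (index-≈ x) (A.trans q (A.sym (index-≈ y))))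
    ; inverse   = (λ { {x} refl → index-≈ x }) , λ {_} {y} q → inj (A.trans (index-≈ y) q)
    }
    where
    index : _ → _
    index (x , p) = proj₁ (surj x p)
    index-≈ : ∀ x → proj₁ (e (index x)) A.≈ proj₁ x
    index-≈ (x , p) = proj₂ (surj x p)

  module _ {k} (size : HasSize A P k) where
    open Inverse size

    enumerate : Fin k → Σ A.Carrier P
    enumerate = to

    enumerate-injective : ∀ {i j} → proj₁ (to i) A.≈ proj₁ (to j) → i ≡ j
    enumerate-injective {i} {j} e = trans (sym (inverseʳ {x = i} {y = to j} (A.sym e))) (inverseʳ {x = j} {y = to j} A.refl)

    enumerate-surjective : ∀ x → P x → ∃[ i ] proj₁ (to i) A.≈ x
    enumerate-surjective x p = from (x , p) , inverseˡ {x = x , p} refl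

count-size : ∀ {n} {P : Pred (Fin n) 0ℓ} (P? : Decidable P) → HasSize (setoid (Fin n)) P (count P?)
count-size {zero} P? = enumeration⇒HasSize (setoid _) (λ ()) (λ { {()} }) (λ ())
count-size {suc n} {P} P? with P? zero | count-size (P? ∘ suc)
... | no ¬p | S = enumeration⇒HasSize (setoid _) (λ i → suc (proj₁ (e i)) , proj₂ (e i))
  (enumerate-injective (setoid _) S ∘ Fin.suc-injective)
  λ { zero p → contradiction p ¬p
    ; (suc x) p → let i , q = enumerate-surjective (setoid _) S x p in i , cong suc q }
  where e = enumerate (setoid _) S
... | yes p₀ | S = enumeration⇒HasSize (setoid _) e′ inj surj
  where
  e = enumerate (setoid _) S
  e′ : Fin (suc (count (P? ∘ suc))) → Σ (Fin (suc n)) P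
  e′ zero    = zero , p₀
  e′ (suc i) = suc (proj₁ (e i)) , proj₂ (e i)
  inj : ∀ {i j} → proj₁ (e′ i) ≡ proj₁ (e′ j) → i ≡ j
  inj {zero}  {zero}  q = refl
  inj {suc i} {suc j} q = cong suc (enumerate-injective (setoid _) S (Fin.suc-injective q))
  surj : ∀ x → P x → ∃[ i ] proj₁ (e′ i) ≡ x
  surj zero    p = zero , refl
  surj (suc x) p = let i , q = enumerate-surjective (setoid _) S x p in suc i , cong suc q

-- `F` need only reflect equality: between the two enumerations it induces an injection of finite
-- index sets.
HasSize-≤ : ∀ {a ℓ p b ℓ′ q} {A : Setoid a ℓ} {P : Pred (Setoid.Carrier A) p}
  {B : Setoid b ℓ′} {Q : Pred (Setoid.Carrier B) q} {k l} → HasSize A P k → HasSize B Q l →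
  (F : Σ _ P → Σ _ Q) → (∀ x y → Setoid._≈_ B (proj₁ (F x)) (proj₁ (F y)) → Setoid._≈_ A (proj₁ x) (proj₁ y)) →
  k ≤ l
HasSize-≤ {A = A} {P} {B} {Q} {k} {l} S T F F-inj = Fin.injective⇒≤ {f = g} g-injective
  where
  module B = Setoid B
  hit : ∀ i → ∃[ j ] proj₁ (enumerate B T j) B.≈ proj₁ (F (enumerate A S i))
  hit i = enumerate-surjective B T _ (proj₂ (F (enumerate A S i)))
  g : Fin k → Fin l
  g i = proj₁ (hit i)
  g-injective : ∀ {i j} → g i ≡ g j → i ≡ j
  g-injective {i} {j} e = enumerate-injective A S (F-inj _ _
    (B.trans (B.sym (proj₂ (hit i))) (B.trans
      (subst (λ u → proj₁ (enumerate B T (g i)) B.≈ proj₁ (enumerate B T u)) e B.refl) (proj₂ (hit j)))))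

HasSize-unique : ∀ {a ℓ p} {A : Setoid a ℓ} {P : Pred (Setoid.Carrier A) p} {k l} →
  HasSize A P k → HasSize A P l → k ≡ l
HasSize-unique S T = ≤-antisym (HasSize-≤ S T id (λ _ _ → id)) (HasSize-≤ T S id (λ _ _ → id))

HasSize-cong : ∀ {a ℓ p q} {A : Setoid a ℓ} {P : Pred (Setoid.Carrier A) p} {Q : Pred (Setoid.Carrier A) q} {k} →
  (∀ x → P x → Q x) → (∀ x → Q x → P x) → HasSize A P k → HasSize A Q k
HasSize-cong {A = A} P⇒Q Q⇒P S = enumeration⇒HasSize A
  (λ i → let x , p = enumerate A S i in x , P⇒Q x p)
  (enumerate-injective A S) (λ x q → enumerate-surjective A S x (Q⇒P x q))

funToFin-cong : ∀ {m n} {f g : Fin m → Fin n} → (∀ x → f x ≡ g x) → funToFin f ≡ funToFin g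
funToFin-cong {zero}  e = refl
funToFin-cong {suc m} e = cong₂ combine (e zero) (funToFin-cong (e ∘ suc))

IsPerm? : ∀ n f → Dec (IsPerm n f)
IsPerm? n f with allUpTo? (λ x → f x <? n) n
  | allUpTo? (λ x → allUpTo? (λ y → f x ≟ f y →-dec x ≟ y) n) n
... | yes b | yes i = yes (record { bounded = b ; injective = λ x<n y<n → i x<n y<n })
... | no ¬b | _     = no (λ P → ¬b (IsPerm.bounded P))
... | _     | no ¬i = no (λ P → ¬i (λ x<n y<n → IsPerm.injective P x<n y<n))

record PermPred (n : ℕ) : Set₁ where
  field
    holds : Permutation′ n → Set
    dec   : ∀ σ → Dec (holds σ)
    resp  : ∀ {σ τ} → σ ≈ τ → holds σ → holds τ

open PermPred

module _ {n : ℕ} where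

  table : Fin (n ^ n) → ℕ → ℕ
  table c = ext (finToFun {n} {n} c)

  -- Self-maps of `Fin n` are coded by the elements of `Fin (n ^ n)`, so permutations are counted as
  -- codes. A code fixes its permutation only up to `_≈_`, hence the use of `resp` in `Coded?`.
  Coded : PermPred n → Pred (Fin (n ^ n)) 0ℓ
  Coded P c = Σ (IsPerm n (table c)) (λ i → holds P (toPerm i))

  toPerm-cong : ∀ {f} (i j : IsPerm n f) → toPerm i ≈ toPerm j
  toPerm-cong i j x = toℕ-injective (trans (toℕ-toPerm i x) (sym (toℕ-toPerm j x)))

  toPerm-table : ∀ {c} (i : IsPerm n (table c)) x → toℕ (toPerm i ⟨$⟩ʳ x) ≡ toℕ (finToFun {n} {n} c x)
  toPerm-table {c} i x = trans (toℕ-toPerm i x) (ext-toℕ (finToFun {n} {n} c) x)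

  Coded? : ∀ P → Decidable (Coded P)
  Coded? P c with IsPerm? n (table c)
  ... | no ¬i = no (¬i ∘ proj₁)
  ... | yes i = map′ (i ,_) (λ (j , p) → resp P (toPerm-cong j i) p) (dec P (toPerm i))

  count-Coded : ∀ P → HasSize (𝔖 n) (holds P) (count (Coded? P))
  count-Coded P = enumeration⇒HasSize (𝔖 n) (λ i → let c , j , p = e i in toPerm j , p) inj surj
    where
    S = count-size (Coded? P)
    e = enumerate (setoid _) S
    inj : ∀ {i j} → toPerm (proj₁ (proj₂ (e i))) ≈ toPerm (proj₁ (proj₂ (e j))) → i ≡ j
    inj {i} {j} q = enumerate-injective (setoid _) S (trans (sym (funToFin-finToFin {n} {n} _))
      (trans (funToFin-cong (λ x → toℕ-injective (trans (sym (toPerm-table (proj₁ (proj₂ (e i))) x))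
        (trans (cong toℕ (q x)) (toPerm-table (proj₁ (proj₂ (e j))) x)))))
        (funToFin-finToFin {n} {n} _)))
    surj : ∀ σ → holds P σ → ∃[ i ] toPerm (proj₁ (proj₂ (e i))) ≈ σ
    surj σ p = i , λ x → toℕ-injective (trans (toPerm-table (proj₁ (proj₂ (e i))) x)
      (cong toℕ (trans (cong (λ c → finToFun {n} {n} c x) eᵢ≡c) (finToFun-funToFin (σ ⟨$⟩ʳ_) x))))
      where
      c : Fin (n ^ n)
      c = funToFin (σ ⟨$⟩ʳ_)
      σ-table : ∀ x → fun σ x ≡ table c x
      σ-table = ext-cong (λ x → sym (finToFun-funToFin (σ ⟨$⟩ʳ_) x))
      c-perm : IsPerm n (table c)
      c-perm = record
        { bounded   = λ {x} x<n → subst (_< n) (σ-table x) (IsPerm.bounded (fun-perm σ) x<n)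
        ; injective = λ {x} {y} x<n y<n q → IsPerm.injective (fun-perm σ) x<n y<n
            (trans (σ-table x) (trans q (sym (σ-table y))))
        }
      found = enumerate-surjective (setoid _) S c (c-perm , resp P
        (λ x → toℕ-injective (sym (trans (toPerm-table c-perm x)
          (cong toℕ (finToFun-funToFin (σ ⟨$⟩ʳ_) x))))) p)
      i = proj₁ found
      eᵢ≡c = proj₂ found

  abstract
    size : PermPred n → ℕ
    size P = count (Coded? P)

    size-HasSize : ∀ P → HasSize (𝔖 n) (holds P) (size P)
    size-HasSize = count-Coded

    size-split : ∀ P Q R → (∀ σ → holds P σ → holds Q σ ⊎ holds R σ) →
      (∀ σ → holds Q σ → holds P σ) → (∀ σ → holds R σ → holds P σ) → (∀ σ → holds Q σ → ¬ holds R σ) →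
      size P ≡ size Q + size R
    size-split P Q R P⇒QR Q⇒P R⇒P Q⇒¬R = count-split (Coded? P) (Coded? Q) (Coded? R)
      split (λ _ (i , q) → i , Q⇒P _ q) (λ _ (i , r) → i , R⇒P _ r)
      (λ _ (i , q) (j , r) → Q⇒¬R _ q (resp R (toPerm-cong j i) r))
      where
      split : ∀ c → Coded P c → Coded Q c ⊎ Coded R c
      split c (i , p) with P⇒QR _ p
      ... | inj₁ q = inj₁ (i , q)
      ... | inj₂ r = inj₂ (i , r)

  size-cong : ∀ P Q → (∀ σ → holds P σ → holds Q σ) → (∀ σ → holds Q σ → holds P σ) → size P ≡ size Q
  size-cong P Q P⇒Q Q⇒P = HasSize-unique (HasSize-cong P⇒Q Q⇒P (size-HasSize P)) (size-HasSize Q)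

-- Inclusion–exclusion

word-cong : ∀ {n} {σ τ : Permutation′ n} → σ ≈ τ → word σ ≡ word τ
word-cong e = tabulate-cong (λ i → cong (suc ∘ toℕ) (e i))

Em? : ∀ {m n} (π : Permutation′ m) (σ : Permutation′ n) → Decidable (Em π σ)
Em? {m} {n} π σ i = 1 ≤? i ×-dec (i + m ≤? n + 1) ×-dec ≡-dec _≟_ _ _

Em-resp : ∀ {m n} (π : Permutation′ m) {σ τ : Permutation′ n} → σ ≈ τ → ∀ {i} → Em π σ i → Em π τ i
Em-resp {m} π {σ} {τ} e {i} (p , q , r) =
  p , q , trans (cong (st ∘ take m ∘ drop (pred i)) (sym (word-cong {σ = σ} {τ} e))) r

module _ {M n : ℕ} where

  Fits : Pred ℕ 0ℓ
  Fits s = s + M < n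

  module _ {S : Pred ℕ 0ℓ} (S? : Decidable S) where

    Agrees : Permutation′ (suc M) → Permutation′ n → Pred ℕ 0ℓ
    Agrees π σ s = (Em π σ (suc s) → S s) × (S s → Em π σ (suc s))

    -- Interpolates between marked and exact occurrences: with `L` empty only the marks in `A` are
    -- prescribed, and with `A` empty and `L` all admissible positions the whole set of occurrences
    -- is.
    joint : Permutation′ (suc M) → List ℕ → List ℕ → PermPred n
    joint π A L = record
      { holds = λ σ → All (Em π σ ∘ suc) A × All (Agrees π σ) L
      ; dec   = λ σ → all? (λ s → Em? π σ (suc s)) A ×-dec
                      all? (λ s → (Em? π σ (suc s) →-dec S? s) ×-dec (S? s →-dec Em? π σ (suc s))) L
      ; resp  = λ {σ} {τ} e (p , q) → All.map (Em-resp π {σ} {τ} e) p ,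
                  All.map (λ (f , g) → f ∘ Em-resp π {τ} {σ} (sym ∘ e) , Em-resp π {σ} {τ} e ∘ g) q
      }

    joint-in : ∀ π A {s} L → S s → size (joint π A (s ∷ L)) ≡ size (joint π (s ∷ A) L)
    joint-in π A {s} L inS = size-cong (joint π A (s ∷ L)) (joint π (s ∷ A) L)
      (λ { σ (p , (f , g) ∷ q) → g inS ∷ p , q })
      (λ { σ (e ∷ p , q) → p , ((λ _ → inS) , (λ _ → e)) ∷ q })

    joint-out : ∀ π A {s} L → ¬ S s →
      size (joint π A L) ≡ size (joint π (s ∷ A) L) + size (joint π A (s ∷ L))
    joint-out π A {s} L ∉S = size-split (joint π A L) (joint π (s ∷ A) L) (joint π A (s ∷ L))
      split
      (λ { σ (_ ∷ p , q) → p , q })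
      (λ { σ (p , _ ∷ q) → p , q })
      (λ { σ (e ∷ _ , _) (_ , (f , _) ∷ _) → ∉S (f e) })
      where
      split : ∀ σ → holds (joint π A L) σ → holds (joint π (s ∷ A) L) σ ⊎ holds (joint π A (s ∷ L)) σ
      split σ (p , q) with Em? π σ (suc s)
      ... | yes e = inj₁ (e ∷ p , q)
      ... | no ¬e = inj₂ (p , ((λ e → contradiction e ¬e) , λ inS → contradiction inS ∉S) ∷ q)

    -- Each position of `L` is traded for marks. If it is in `S`, it becomes a mark; if not, the
    -- count is that without the condition minus that with a mark there, and the subtraction is done
    -- by cancellation.
    sieve : ∀ π τ → (∀ A → All Fits A → size (joint π A []) ≡ size (joint τ A [])) →
      ∀ L → All Fits L → ∀ A → All Fits A → size (joint π A L) ≡ size (joint τ A L)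
    sieve π τ base []      _          A fA = base A fA
    sieve π τ base (s ∷ L) (fs ∷ fL) A fA with S? s
    ... | yes inS = trans (joint-in π A L inS)
            (trans (sieve π τ base L fL (s ∷ A) (fs ∷ fA)) (sym (joint-in τ A L inS)))
    ... | no ∉S = +-cancelˡ-≡ (size (joint π (s ∷ A) L)) _ _ (begin
      size (joint π (s ∷ A) L) + size (joint π A (s ∷ L)) ≡⟨ joint-out π A L ∉S ⟨
      size (joint π A L)                                  ≡⟨ sieve π τ base L fL A fA ⟩
      size (joint τ A L)                                  ≡⟨ joint-out τ A L ∉S ⟩
      size (joint τ (s ∷ A) L) + size (joint τ A (s ∷ L))
        ≡⟨ cong (_+ size (joint τ A (s ∷ L))) (sieve π τ base L fL (s ∷ A) (fs ∷ fA)) ⟨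
      size (joint π (s ∷ A) L) + size (joint τ A (s ∷ L)) ∎)
      where open ≡-Reasoning

    -- `R` and `T` are tied to the patterns by implications only, because the order of `π ᴿ` matches
    -- `Reversed M (Pat π)` just at offsets up to `M`.
    embedding⇒≤ : ∀ π τ A {R T} → All Fits A → Embedding n M (_∈ A) R T →
      (∀ {f s} → Occurs M (Pat π) f s → Occurs M R f s) →
      (∀ {f s} → Occurs M T f s → Occurs M (Pat τ) f s) →
      size (joint π A []) ≤ size (joint τ A [])
    embedding⇒≤ π τ A {R} {T} fA E π⇒R T⇒τ = HasSize-≤ (size-HasSize (joint π A [])) (size-HasSize (joint τ A []))
      F F-injective
      where
      module E = Embedding E
      occ : ∀ σ → All (Em π σ ∘ suc) A → ∀ {s} → s ∈ A → Occurs M R (fun σ) s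
      occ σ p s∈A = π⇒R {fun σ} (Em⇒Occurs π σ (All.lookup p s∈A))
      F : Σ _ (holds (joint π A [])) → Σ _ (holds (joint τ A []))
      F (σ , p , _) = σ′ , All.tabulate em , []
        where
        P = E.perm (fun-perm σ)
        σ′ = toPerm P
        em : ∀ {s} → s ∈ A → Em τ σ′ (suc s)
        em {s} s∈A = Occurs⇒Em τ σ′ (All.lookup fA s∈A) λ {a} {b} a≤M b≤M q →
          subst₂ _<_ (sym (fun-toPerm P (inside a≤M))) (sym (fun-toPerm P (inside b≤M)))
            (T⇒τ {E.map-to (fun σ)} (E.occurs (fun-perm σ) (occ σ p) s∈A) a≤M b≤M q)
          where
          inside : ∀ {a} → a ≤ M → s + a < n
          inside a≤M = ≤-<-trans (+-monoʳ-≤ s a≤M) (All.lookup fA s∈A)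
      F-injective : ∀ x y → proj₁ (F x) ≈ proj₁ (F y) → proj₁ x ≈ proj₁ y
      F-injective (σ , p , _) (τ , q , _) e = fun-injective σ τ (E.injective
        (fun-perm σ) (occ σ p) (fun-perm τ) (occ τ q) λ {x} x<n → begin
          E.map-to (fun σ) x                      ≡⟨ fun-toPerm (E.perm (fun-perm σ)) x<n ⟨
          fun (toPerm (E.perm (fun-perm σ))) x    ≡⟨ ext-cong e x ⟩
          fun (toPerm (E.perm (fun-perm τ))) x    ≡⟨ fun-toPerm (E.perm (fun-perm τ)) x<n ⟩
          E.map-to (fun τ) x                      ∎)
        where open ≡-Reasoning

    sizes-reverse : ∀ π → Good M (Pat π) → ∀ A → All Fits A →
      size (joint π A []) ≡ size (joint (π ᴿ) A [])
    sizes-reverse π gd A fA = ≤-antisym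
      (embedding⇒≤ π (π ᴿ) A fA (embed-reversed (All.lookup fA) (_∈? A) gd) (λ X → X)
        (λ X a≤M b≤M p → X a≤M b≤M (subst₂ _<_ (fun-reverse π a≤M) (fun-reverse π b≤M) p)))
      (embedding⇒≤ (π ᴿ) π A fA (embed-back (All.lookup fA) (_∈? A) gd)
        (λ X a≤M b≤M p → X a≤M b≤M (subst₂ _<_ (sym (fun-reverse π a≤M)) (sym (fun-reverse π b≤M)) p))
        (λ X → X))

  EqualSizes : Permutation′ (suc M) → Permutation′ (suc M) → Set₁
  EqualSizes π τ = ∀ {S : Pred ℕ 0ℓ} (S? : Decidable S) A → All Fits A →
    size (joint S? π A []) ≡ size (joint S? τ A [])

  module _ {π τ : Permutation′ (suc M)} (equal : EqualSizes π τ) {S : Pred ℕ 0ℓ} where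

    -- S is decidable and consists of admissible positions as soon as it is a set Em ρ σ.
    count-transfer : ∀ (ρ : Permutation′ (suc M)) σ → Em ρ σ ≐ S → ∀ {k} → Count π n S k → Count τ n S k
    count-transfer ρ σ (Em⊆S , S⊆Em) {k} C =
      subst (Count τ n S) (sym k≡) (exact τ)
      where
      S? : Decidable (S ∘ suc)
      S? s = map′ Em⊆S S⊆Em (Em? ρ σ (suc s))
      -- These are exactly the 0-based positions `s` with `s + M < n`.
      L = upTo (n ∸ M)
      fits : All Fits L
      fits = All.map (λ {s} s< → m≤o∸n⇒m+n≤o (suc s) (<⇒≤ (m∸n≢0⇒n<m (m<n⇒n≢0 s<))) s<) (all-upTo (n ∸ M))
      listed : ∀ {s} → Fits s → s ∈ L
      listed {s} s+M<n = ∈-upTo⁺ (m+n≤o⇒m≤o∸n (suc s) s+M<n)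
      exact : ∀ ρ′ → Count ρ′ n S (size (joint S? ρ′ [] L))
      exact ρ′ = HasSize-cong to from (size-HasSize (joint S? ρ′ [] L))
        where
        to : ∀ σ′ → holds (joint S? ρ′ [] L) σ′ → Em ρ′ σ′ ≐ S
        to σ′ (_ , q) =
          (λ { {suc s} e → proj₁ (All.lookup q (listed (Em⇒< ρ′ σ′ e))) e }) ,
          (λ { {zero} z → contradiction (proj₁ (S⊆Em z)) λ ()
             ; {suc s} z → proj₂ (All.lookup q (listed (Em⇒< ρ σ (S⊆Em z)))) z })
        from : ∀ σ′ → Em ρ′ σ′ ≐ S → holds (joint S? ρ′ [] L) σ′
        from σ′ (f , g) = [] , All.tabulate (λ _ → f , g)
      k≡ : k ≡ size (joint S? τ [] L)
      k≡ = trans (HasSize-unique C (exact π)) (sieve S? π τ (equal S?) L fits [] [])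

    -- `count-transfer` needs a witness that `S` is a set of occurrences. A positive count provides
    -- one for `π`. For count zero, a permutation counted for `τ` would itself be one, and the
    -- transferred count zero would contradict its existence.
    count⇒ : ∀ {k} → Count π n S k → Count τ n S k
    count⇒ {suc k} C = let σ , e = enumerate (𝔖 n) C zero in count-transfer π σ e C
    count⇒ {zero}  C = enumeration⇒HasSize (𝔖 n) (λ ()) (λ { {()} })
      (λ σ e → contradiction (proj₁ (enumerate-surjective (𝔖 n) (count-transfer τ σ e C) σ e)) Fin.¬Fin0)

theorem5p6 : ∀ (m : ℕ) (π : Permutation′ m) →
    head (word π) ≡ just 1 →
    last (word π) ≡ just m →
    HasSize (setoid ℕ) (Overlap π) 2 →
    SuperStronglyCWilfEquivalent π (π ᴿ)
theorem5p6 zero    π () lst two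
theorem5p6 (suc M) π hd lst two n S _ k = mk⇔
  (count⇒ {π = π} {π ᴿ} forth) (count⇒ {π = π ᴿ} {π} back)
  where
  forth : EqualSizes π (π ᴿ)
  forth S? A fA = sizes-reverse S? π (good π hd lst two) A fA
  back : EqualSizes (π ᴿ) π
  back S? A fA = sym (forth S? A fA)
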